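{- The class of outerplanar graphs has the homomorphism preservation property.
   Context: Graphs are finite, simple and undirected. A graph is outerplanar if it has neither $K_4$ nor $K_{2,3}$ as a minor. A first-order sentence $\phi$ (in the language of graphs) is preserved by homomorphisms over a class $\mathcal{C}$ if for all $A,B\in\mathcal{C}$ with a homomorphism $A\to B$, $A\models\phi$ implies $B\models\phi$; $\mathcal{C}$ has the homomorphism preservation property if every such sentence is equivalent on all graphs of $\mathcal{C}$ to an existential-positive first-order sentence. -}

module Defs where

open import Data.Nat using (ℕ; zero; suc; _<ᵇ_)
open import Data.Fin using (Fin; toℕ)
open import Data.Fin.Properties using (_≟_)
open import Data.Bool using (Bool; true; false; not; _xor_)
open import Data.Maybe using (Maybe; just; nothing)
open import Data.Product using (Σ; _×_; _,_; ∃; ∃-syntax)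
open import Data.Sum using (_⊎_)
open import Data.Empty using (⊥)
open import Data.Unit using (⊤)
open import Relation.Nullary using (¬_; does)
open import Relation.Binary.PropositionalEquality using (_≡_)

record Graph : Set where
  field
    size  : ℕ
    adj   : Fin size → Fin size → Bool
    sym   : ∀ x y → adj x y ≡ adj y x
    irrefl : ∀ x → adj x x ≡ false
open Graph public

Vertex : Graph → Set
Vertex G = Fin (size G)

Edge : (G : Graph) → Vertex G → Vertex G → Set
Edge G x y = adj G x y ≡ true

Hom : Graph → Graph → Set
Hom A B = Σ (Vertex A → Vertex B) λ f → ∀ x y → Edge A x y → Edge B (f x) (f y)

-- Minors (via minor models / branch sets).
-- H is a minor of G iff there is a partial map β : V(G) ⇀ V(H) such that
-- each branch set β⁻¹(h) is nonempty and connected in G, and for each edge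
-- h₁h₂ of H there is an edge of G between β⁻¹(h₁) and β⁻¹(h₂).
-- (Disjointness of branch sets is automatic since β is a function.)

data ReachIn (G : Graph) (S : Vertex G → Set) : Vertex G → Vertex G → Set where
  here : ∀ {x} → S x → ReachIn G S x x
  step : ∀ {x y z} → ReachIn G S x y → Edge G y z → S z → ReachIn G S x z

record MinorModel (H G : Graph) : Set where
  field
    branch    : Vertex G → Maybe (Vertex H)
    nonempty  : ∀ h → ∃[ g ] branch g ≡ just h
    connected : ∀ h g₁ g₂ → branch g₁ ≡ just h → branch g₂ ≡ just h →
                ReachIn G (λ g → branch g ≡ just h) g₁ g₂
    edges     : ∀ h₁ h₂ → Edge H h₁ h₂ →
                ∃[ g₁ ] ∃[ g₂ ] (branch g₁ ≡ just h₁ × branch g₂ ≡ just h₂ × Edge G g₁ g₂)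

IsMinorOf : Graph → Graph → Set
IsMinorOf H G = MinorModel H G

open Data.Fin using (zero; suc)
open import Relation.Binary.PropositionalEquality using (refl)

private
  k4adj : Fin 4 → Fin 4 → Bool
  k4adj i j = not (does (i ≟ j))

  k4sym : ∀ x y → k4adj x y ≡ k4adj y x
  k4sym zero zero = refl
  k4sym zero (suc zero) = refl
  k4sym zero (suc (suc zero)) = refl
  k4sym zero (suc (suc (suc zero))) = refl
  k4sym (suc zero) zero = refl
  k4sym (suc zero) (suc zero) = refl
  k4sym (suc zero) (suc (suc zero)) = refl
  k4sym (suc zero) (suc (suc (suc zero))) = refl
  k4sym (suc (suc zero)) zero = refl
  k4sym (suc (suc zero)) (suc zero) = refl
  k4sym (suc (suc zero)) (suc (suc zero)) = refl
  k4sym (suc (suc zero)) (suc (suc (suc zero))) = refl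
  k4sym (suc (suc (suc zero))) zero = refl
  k4sym (suc (suc (suc zero))) (suc zero) = refl
  k4sym (suc (suc (suc zero))) (suc (suc zero)) = refl
  k4sym (suc (suc (suc zero))) (suc (suc (suc zero))) = refl

  k4irr : ∀ x → k4adj x x ≡ false
  k4irr zero = refl
  k4irr (suc zero) = refl
  k4irr (suc (suc zero)) = refl
  k4irr (suc (suc (suc zero))) = refl

K4 : Graph
K4 = record { size = 4 ; adj = k4adj ; sym = k4sym ; irrefl = k4irr }

private
  k23adj : Fin 5 → Fin 5 → Bool
  k23adj i j = (toℕ i <ᵇ 2) xor (toℕ j <ᵇ 2)

  k23sym : ∀ x y → k23adj x y ≡ k23adj y x
  k23sym zero zero = refl
  k23sym zero (suc zero) = refl
  k23sym zero (suc (suc zero)) = refl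
  k23sym zero (suc (suc (suc zero))) = refl
  k23sym zero (suc (suc (suc (suc zero)))) = refl
  k23sym (suc zero) zero = refl
  k23sym (suc zero) (suc zero) = refl
  k23sym (suc zero) (suc (suc zero)) = refl
  k23sym (suc zero) (suc (suc (suc zero))) = refl
  k23sym (suc zero) (suc (suc (suc (suc zero)))) = refl
  k23sym (suc (suc zero)) zero = refl
  k23sym (suc (suc zero)) (suc zero) = refl
  k23sym (suc (suc zero)) (suc (suc zero)) = refl
  k23sym (suc (suc zero)) (suc (suc (suc zero))) = refl
  k23sym (suc (suc zero)) (suc (suc (suc (suc zero)))) = refl
  k23sym (suc (suc (suc zero))) zero = refl
  k23sym (suc (suc (suc zero))) (suc zero) = refl
  k23sym (suc (suc (suc zero))) (suc (suc zero)) = refl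
  k23sym (suc (suc (suc zero))) (suc (suc (suc zero))) = refl
  k23sym (suc (suc (suc zero))) (suc (suc (suc (suc zero)))) = refl
  k23sym (suc (suc (suc (suc zero)))) zero = refl
  k23sym (suc (suc (suc (suc zero)))) (suc zero) = refl
  k23sym (suc (suc (suc (suc zero)))) (suc (suc zero)) = refl
  k23sym (suc (suc (suc (suc zero)))) (suc (suc (suc zero))) = refl
  k23sym (suc (suc (suc (suc zero)))) (suc (suc (suc (suc zero)))) = refl

  k23irr : ∀ x → k23adj x x ≡ false
  k23irr zero = refl
  k23irr (suc zero) = refl
  k23irr (suc (suc zero)) = refl
  k23irr (suc (suc (suc zero))) = refl
  k23irr (suc (suc (suc (suc zero)))) = refl

K23 : Graph
K23 = record { size = 5 ; adj = k23adj ; sym = k23sym ; irrefl = k23irr }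

Outerplanar : Graph → Set
Outerplanar G = ¬ IsMinorOf K4 G × ¬ IsMinorOf K23 G

data Formula : ℕ → Set where
  tt ff   : ∀ {k} → Formula k
  E       : ∀ {k} → Fin k → Fin k → Formula k
  Eq      : ∀ {k} → Fin k → Fin k → Formula k
  neg     : ∀ {k} → Formula k → Formula k
  _and_   : ∀ {k} → Formula k → Formula k → Formula k
  _or_    : ∀ {k} → Formula k → Formula k → Formula k
  ex      : ∀ {k} → Formula (suc k) → Formula k
  all     : ∀ {k} → Formula (suc k) → Formula k

Sentence : Set
Sentence = Formula 0

extend : ∀ {k} {A : Set} → A → (Fin k → A) → Fin (suc k) → A
extend a ρ zero    = a
extend a ρ (suc i) = ρ i

Sat : ∀ {k} (G : Graph) → Formula k → (Fin k → Vertex G) → Set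
Sat G tt        ρ = ⊤
Sat G ff        ρ = ⊥
Sat G (E i j)   ρ = Edge G (ρ i) (ρ j)
Sat G (Eq i j)  ρ = ρ i ≡ ρ j
Sat G (neg φ)   ρ = ¬ Sat G φ ρ
Sat G (φ and ψ) ρ = Sat G φ ρ × Sat G ψ ρ
Sat G (φ or ψ)  ρ = Sat G φ ρ ⊎ Sat G ψ ρ
Sat G (ex φ)    ρ = ∃[ v ] Sat G φ (extend v ρ)
Sat G (all φ)   ρ = ∀ v → Sat G φ (extend v ρ)

emptyEnv : (G : Graph) → Fin 0 → Vertex G
emptyEnv G ()

_⊨_ : Graph → Sentence → Set
G ⊨ φ = Sat G φ (emptyEnv G)

data ExPos : ∀ {k} → Formula k → Set where
  tt  : ∀ {k} → ExPos {k} tt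
  ff  : ∀ {k} → ExPos {k} ff
  E   : ∀ {k} (i j : Fin k) → ExPos (E i j)
  Eq  : ∀ {k} (i j : Fin k) → ExPos (Eq i j)
  and : ∀ {k} {φ ψ : Formula k} → ExPos φ → ExPos ψ → ExPos (φ and ψ)
  or  : ∀ {k} {φ ψ : Formula k} → ExPos φ → ExPos ψ → ExPos (φ or ψ)
  ex  : ∀ {k} {φ : Formula (suc k)} → ExPos φ → ExPos (ex φ)

PreservedByHomOver : (Graph → Set) → Sentence → Set
PreservedByHomOver C φ = ∀ A B → C A → C B → Hom A B → A ⊨ φ → B ⊨ φ

HPP : (Graph → Set) → Set
HPP C = ∀ (φ : Sentence) → PreservedByHomOver C φ →
        ∃[ ψ ] (ExPos ψ × (∀ G → C G → (G ⊨ φ → G ⊨ ψ) × (G ⊨ ψ → G ⊨ φ)))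

{-# OPTIONS --safe #-}
module Submission where

-- An outerplanar graph with an odd cycle is homomorphically equivalent to its shortest one, C: each component of
-- the rest is attached to C at the ends of a single edge of C (otherwise there is a K4 or K23 minor), so the two
-- sides of that edge can be mapped to C separately and glued. Hence, up to homomorphic equivalence, the
-- outerplanar graphs form the chain ∅, K1, K2, …, C7, C5, C3. A first-order sentence cannot tell long odd cycles
-- from long even ones, which map to K2; so if a preserved sentence φ fails in K2, then it fails in some odd cycle
-- of length 2k + 3, and for the least such k it says that there is a closed walk of length 2k + 1.

open import Defs
open import Data.Nat using (ℕ; zero; suc; _+_; _*_; _∸_; _≤_; _<_; z≤n; s≤s; s≤s⁻¹; NonZero; >-nonZero; _<?_; _⊔_)
open import Data.Nat.Properties as ℕₚ using (≤-refl; ≤-trans; ≤-reflexive; <-trans; ≤-<-trans; <-≤-trans; <-cmp; +-comm; +-assoc; +-suc; +-identityʳ; +-mono-≤; m≤m+n; m≤n+m; n≤1+n; m∸n+n≡m; m+[n∸m]≡n)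
open import Data.Nat.DivMod using (_%_; _/_; _mod_; m≡m%n+[m/n]*n; m%n<n; m%n%n≡m%n; m<n⇒m%n≡m; n%n≡0; [m+n]%n≡m%n; [m+kn]%n≡m%n; %-distribˡ-+; %-distribˡ-*; m∣n⇒o%n%m≡o%m)
open import Data.Nat.Divisibility using (_∣_; divides)
open import Data.Nat.Induction using (<-wellFounded)
open import Induction.WellFounded using (Acc; acc)
open import Data.Fin using (Fin; zero; suc; toℕ; fromℕ<; combine; remQuot)
open import Data.Fin.Properties using (_≟_; any?; all?; toℕ<n; toℕ-injective; toℕ-fromℕ<; injective⇒≤; remQuot-combine)
open import Data.Fin.Patterns using (0F; 1F; 2F; 3F; 4F)
open import Data.Bool using (Bool; true; false; not; _∧_; _∨_; _xor_; if_then_else_)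
open import Data.Bool.Properties using (∨-comm; ∧-comm; ∧-zeroʳ; ∨-zeroʳ; ¬-not) renaming (_≟_ to _≟ᵇ_)
open import Data.Maybe using (Maybe; just; nothing)
open import Data.Maybe.Properties using (just-injective)
open import Data.Product using (Σ; _×_; _,_; ∃; ∃-syntax; proj₁; proj₂; swap)
open import Data.Sum using (_⊎_; inj₁; inj₂; [_,_]′) renaming (swap to ⊎-swap; map to ⊎-map)
open import Data.Empty using (⊥; ⊥-elim)
open import Data.Unit using (⊤; tt)
open import Function using (_∘_; id)
open import Relation.Nullary using (¬_; Dec; yes; no; does; contradiction)
open import Relation.Nullary.Decidable using (_×-dec_; _⊎-dec_; ¬?; map′; dec-true; dec-false)
open import Relation.Binary.Definitions using (tri<; tri≈; tri>)
open import Relation.Binary.PropositionalEquality using (_≡_; _≢_; refl; trans; cong; cong₂; subst) renaming (sym to ≡-sym)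

-- Congruences and labellings modulo N

-- Cutting a graph along an edge of C may leave a side without odd cycles, or with only longer ones.
-- The induction therefore proves: an outerplanar graph without closed walks of odd length below N,
-- where N is odd, maps to the N-cycle (a loop if N is 1). This hypothesis passes to subgraphs, and
-- longer odd cycles are handled by folding a cycle of length N + 2 onto one of length N. The maps
-- of the two sides need not agree on the shared edge. Rotations and reflections of the cycle carry
-- any directed edge to any other, so agreement can be arranged. Closed walks replace cycles: they
-- can be searched for and expressed by existential-positive formulas, and a shortest odd one is
-- automatically a chordless cycle, since a repeated vertex or a chord would cut it into two closed
-- walks of smaller length, one of them odd. Maps to cycles are written as natural numbers modulo
-- the length, which turns rotation, reflection and folding into arithmetic.

record Cong (N : ℕ) .{{_ : NonZero N}} (a b : ℕ) : Set where
  constructor residues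
  field residue-≡ : a % N ≡ b % N
open Cong

module _ {N : ℕ} .{{_ : NonZero N}} where

  Cong-refl : ∀ {a} → Cong N a a
  Cong-refl = residues refl

  Cong-reflexive : ∀ {a b} → a ≡ b → Cong N a b
  Cong-reflexive refl = Cong-refl

  Cong-sym : ∀ {a b} → Cong N a b → Cong N b a
  Cong-sym (residues p) = residues (≡-sym p)

  Cong-trans : ∀ {a b c} → Cong N a b → Cong N b c → Cong N a c
  Cong-trans (residues p) (residues q) = residues (trans p q)

  Cong-+ : ∀ {a b c d} → Cong N a b → Cong N c d → Cong N (a + c) (b + d)
  Cong-+ {a} {b} {c} {d} (residues p) (residues q) = residues
    (trans (%-distribˡ-+ a c N) (trans (cong₂ (λ x y → (x + y) % N) p q) (≡-sym (%-distribˡ-+ b d N))))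

  Cong-* : ∀ {a b c d} → Cong N a b → Cong N c d → Cong N (a * c) (b * d)
  Cong-* {a} {b} {c} {d} (residues p) (residues q) = residues
    (trans (%-distribˡ-* a c N) (trans (cong₂ (λ x y → (x * y) % N) p q) (≡-sym (%-distribˡ-* b d N))))

  Cong-suc : ∀ {a b} → Cong N a b → Cong N (suc a) (suc b)
  Cong-suc = Cong-+ {1} {1} Cong-refl

  Cong-% : ∀ a → Cong N (a % N) a
  Cong-% a = residues (m%n%n≡m%n a N)

  Cong-+N : ∀ a → Cong N (a + N) a
  Cong-+N a = residues ([m+n]%n≡m%n a N)

  Cong-+*N : ∀ a k → Cong N (a + k * N) a
  Cong-+*N a k = residues ([m+kn]%n≡m%n a k N)

Near : (N : ℕ) .{{_ : NonZero N}} → ℕ → ℕ → Set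
Near N a b = Cong N b (suc a) ⊎ Cong N a (suc b)

Near-resp : ∀ {N} .{{_ : NonZero N}} {a a′ b b′} → Cong N a a′ → Cong N b b′ → Near N a b → Near N a′ b′
Near-resp p q (inj₁ r) = inj₁ (Cong-trans (Cong-sym q) (Cong-trans r (Cong-suc p)))
Near-resp p q (inj₂ r) = inj₂ (Cong-trans (Cong-sym p) (Cong-trans r (Cong-suc q)))

-- A homomorphism to the N-cycle, with the vertices of the cycle taken as residues.
Labelling : (N : ℕ) .{{_ : NonZero N}} → Graph → Set
Labelling N G = Σ (Vertex G → ℕ) λ f → ∀ x y → Edge G x y → Near N (f x) (f y)

relabel : ∀ {N N′} .{{_ : NonZero N}} .{{_ : NonZero N′}} {G} (g : ℕ → ℕ) →
          (∀ {a b} → Cong N b (suc a) → Near N′ (g a) (g b)) → Labelling N G → Labelling N′ G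
relabel g p (f , e) = (λ x → g (f x)) , λ x y xy → [ p , (λ q → ⊎-swap (p q)) ]′ (e x y xy)

-- The cycle has an automorphism taking any directed edge to the one from 0 to 1. If `uv` is
-- labelled forwards, rotate by -`f u`; if backwards, reflect by `a ↦ f u − a`. Negation is
-- multiplication by `M`, which is -1 modulo `suc M`.
normalise : ∀ {M G u v} → Edge G u v → Labelling (suc M) G →
            Σ (Labelling (suc M) G) λ (f , _) → Cong (suc M) (f u) 0 × Cong (suc M) (f v) 1
normalise {M} {G} {u} {v} uv L@(f , e) with e u v uv
... | inj₁ v≈1+u = relabel {G = G} (_+ M * f u) (λ q → inj₁ (Cong-+ q Cong-refl)) L
                 , Cong-+*N′ 0 , Cong-trans (Cong-+ v≈1+u Cong-refl) (Cong-+*N′ 1)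
  where
  Cong-+*N′ : ∀ a → Cong (suc M) (a + (f u + M * f u)) a
  Cong-+*N′ a = Cong-trans (Cong-reflexive (cong (a +_) (ℕₚ.*-comm (suc M) (f u)))) (Cong-+*N a (f u))
... | inj₂ u≈1+v = relabel {G = G} (λ a → M * a + f u) (λ q → inj₂ (reverse q)) L
                 , Cong-trans (Cong-reflexive (trans (+-comm (M * f u) (f u)) (ℕₚ.*-comm (suc M) (f u)))) (Cong-+*N 0 (f u))
                 , Cong-trans (Cong-+ {a = M * f v} Cong-refl u≈1+v)
                     (Cong-trans (Cong-reflexive (trans (+-suc (M * f v) (f v)) (cong suc (trans (+-comm (M * f v) (f v)) (ℕₚ.*-comm (suc M) (f v))))))
                       (Cong-+*N 1 (f v)))
  where
  reverse : ∀ {a b} → Cong (suc M) b (suc a) → Cong (suc M) (M * a + f u) (suc (M * b + f u))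
  reverse {a} {b} q = Cong-sym (Cong-trans (Cong-suc (Cong-+ (Cong-* {a = M} Cong-refl q) Cong-refl))
    (Cong-trans (Cong-reflexive eq) (Cong-+N (M * a + f u))))
    where
    eq : suc (M * suc a + f u) ≡ (M * a + f u) + suc M
    eq = trans (cong (λ z → suc (z + f u)) (ℕₚ.*-suc M a))
           (trans (cong suc (+-assoc M (M * a) (f u))) (+-comm (suc M) (M * a + f u)))

-- Folding a cycle of length N + 2 onto one of length N by r ↦ ∣ r − 1 ∣.
∣_-1∣ : ℕ → ℕ
∣ zero -1∣ = 1
∣ suc r -1∣ = r

fold : ∀ {M G} → Labelling (suc (suc (suc M))) G → Labelling (suc M) G
fold {M} {G} = relabel {G = G} (λ a → ∣ a % N -1∣) folded
  where
  N : ℕ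
  N = suc (suc (suc M))
  residue-suc : ∀ r → r < N → (suc r % N ≡ suc r) ⊎ (suc r ≡ N)
  residue-suc r r<N with suc r <? N
  ... | yes p = inj₁ (m<n⇒m%n≡m p)
  ... | no ¬p = inj₂ (ℕₚ.≤-antisym r<N (ℕₚ.≮⇒≥ ¬p))
  step-case : ∀ r r′ → r < N → r′ ≡ suc r % N → Near (suc M) ∣ r -1∣ ∣ r′ -1∣
  step-case r r′ r<N r′≡ with residue-suc r r<N
  step-case zero r′ r<N r′≡ | inj₁ p rewrite trans r′≡ p = inj₂ Cong-refl
  step-case (suc r) r′ r<N r′≡ | inj₁ p rewrite trans r′≡ p = inj₁ Cong-refl
  -- The step closing the long cycle, from `M + 2` to 0, goes to the step from `M + 1`, which is 0
  -- modulo the new length, to 1.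
  step-case r r′ r<N r′≡ | inj₂ refl rewrite trans r′≡ (n%n≡0 N) = inj₁ (Cong-sym (Cong-+N 1))
  folded : ∀ {a b} → Cong N b (suc a) → Near (suc M) ∣ a % N -1∣ ∣ b % N -1∣
  folded {a} {b} (residues q) = step-case (a % N) (b % N) (m%n<n a N)
    (trans q (residue-≡ (Cong-suc {N} (Cong-sym (Cong-% a)))))

-- Cycles

module _ {M : ℕ} where

  private
    N : ℕ
    N = suc M

  toℕ-mod : ∀ a → Cong N (toℕ (a mod N)) a
  toℕ-mod a = Cong-trans (Cong-reflexive (toℕ-fromℕ< (m%n<n a N))) (Cong-% a)

  toℕ-Cong-injective : ∀ {x y : Fin N} → Cong N (toℕ x) (toℕ y) → x ≡ y
  toℕ-Cong-injective {x} {y} (residues p) = toℕ-injective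
    (trans (≡-sym (m<n⇒m%n≡m (toℕ<n x))) (trans p (m<n⇒m%n≡m (toℕ<n y))))

  shift : ℕ → Fin N → Fin N
  shift d x = (d + toℕ x) mod N

  toℕ-shift : ∀ d x → Cong N (toℕ (shift d x)) (d + toℕ x)
  toℕ-shift d x = toℕ-mod (d + toℕ x)

  shift-shift : ∀ d e x → shift d (shift e x) ≡ shift (d + e) x
  shift-shift d e x = toℕ-Cong-injective (Cong-trans (toℕ-shift d _)
    (Cong-trans (Cong-+ {a = d} Cong-refl (toℕ-shift e x))
      (Cong-trans (Cong-reflexive (≡-sym (+-assoc d e (toℕ x)))) (Cong-sym (toℕ-shift (d + e) x)))))

  shift-comm : ∀ d e x → shift d (shift e x) ≡ shift e (shift d x)
  shift-comm d e x = trans (shift-shift d e x)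
    (trans (cong (λ c → shift c x) (+-comm d e)) (≡-sym (shift-shift e d x)))

  shift-zero : ∀ x → shift 0 x ≡ x
  shift-zero x = toℕ-Cong-injective (toℕ-shift 0 x)

  shift-multiple : ∀ k x → shift (k * N) x ≡ x
  shift-multiple k x = toℕ-Cong-injective (Cong-trans (toℕ-shift (k * N) x)
    (Cong-trans (Cong-reflexive (+-comm (k * N) (toℕ x))) (Cong-+*N (toℕ x) k)))

  -- `M` is -1 modulo `N`, so going back is again a shift ahead and no truncated subtraction occurs.
  unshift : ℕ → Fin N → Fin N
  unshift d = shift (d * M)

  unshift-shift : ∀ d x → unshift d (shift d x) ≡ x
  unshift-shift d x = trans (shift-shift (d * M) d x)
    (trans (cong (λ c → shift c x) (trans (+-comm (d * M) d) (≡-sym (ℕₚ.*-suc d M)))) (shift-multiple d x))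

  shift-unshift : ∀ d x → shift d (unshift d x) ≡ x
  shift-unshift d x = trans (shift-comm d (d * M) x) (unshift-shift d x)

  shift-injective : ∀ d {x y} → shift d x ≡ shift d y → x ≡ y
  shift-injective d {x} {y} p = trans (≡-sym (unshift-shift d x)) (trans (cong (unshift d) p) (unshift-shift d y))

  shift-free : ∀ {d x} → d < N → shift d x ≡ x → d ≡ 0
  shift-free {d} {x} d<N p = trans (≡-sym (m<n⇒m%n≡m d<N)) (residue-≡ d≈0)
    where
    x* : ∀ a → Cong N (a + toℕ x + M * toℕ x) a
    x* a = Cong-trans (Cong-reflexive (trans (+-assoc a _ _) (cong (a +_) (ℕₚ.*-comm N (toℕ x))))) (Cong-+*N a (toℕ x))
    d≈0 : Cong N d 0
    d≈0 = Cong-trans (Cong-sym (x* d)) (Cong-trans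
      (Cong-+ (Cong-trans (Cong-sym (toℕ-shift d x)) (Cong-reflexive (cong toℕ p))) Cong-refl) (x* 0))

  next prev : Fin N → Fin N
  next = shift 1
  prev = unshift 1

∨-true : ∀ {a b} → a ∨ b ≡ true → (a ≡ true) ⊎ (b ≡ true)
∨-true {true}  p = inj₁ refl
∨-true {false} p = inj₂ p

does-true : ∀ {A : Set} {d : Dec A} → does d ≡ true → A
does-true {d = yes a} p = a

-- The cycle of length M + 2.
Cyc : ℕ → Graph
Cyc M = record
  { size = suc (suc M)
  ; adj = λ x y → does (next x ≟ y) ∨ does (next y ≟ x)
  ; sym = λ x y → ∨-comm (does (next x ≟ y)) _
  ; irrefl = λ x → ¬-not λ p → [ loop x , loop x ]′ (∨-true p)
  }
  where
  loop : ∀ x → does (next {suc M} x ≟ x) ≡ true → ⊥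
  loop x p with next x ≟ x
  ... | yes q with () ← shift-free {d = 1} {x} (s≤s (s≤s z≤n)) q

Cyc-edge⁻ : ∀ {M} x y → Edge (Cyc M) x y → (next x ≡ y) ⊎ (next y ≡ x)
Cyc-edge⁻ x y p = ⊎-map (does-true {d = next x ≟ y}) (does-true {d = next y ≟ x}) (∨-true p)

Cyc-edge⁺ : ∀ {M} x y → (next x ≡ y) ⊎ (next y ≡ x) → Edge (Cyc M) x y
Cyc-edge⁺ {M} x y (inj₁ p) = cong (_∨ does (next y ≟ x)) (dec-true (next x ≟ y) p)
Cyc-edge⁺ {M} x y (inj₂ p) = trans (cong (does (next x ≟ y) ∨_) (dec-true (next y ≟ x) p)) (∨-zeroʳ _)

labelling⇒hom : ∀ {M G} → Labelling (suc (suc M)) G → Hom G (Cyc M)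
labelling⇒hom {M} {G} (f , e) = (λ x → f x mod _) , λ x y xy →
  Cyc-edge⁺ (f x mod _) (f y mod _) (⊎-map (next-mod (f x) (f y)) (next-mod (f y) (f x)) (e x y xy))
  where
  next-mod : ∀ a b → Cong (suc (suc M)) b (suc a) → next (a mod suc (suc M)) ≡ b mod suc (suc M)
  next-mod a b q = toℕ-Cong-injective (Cong-trans (toℕ-shift 1 (a mod _))
    (Cong-trans (Cong-suc (toℕ-mod a)) (Cong-trans (Cong-sym q) (Cong-sym (toℕ-mod b)))))

double : ℕ → ℕ
double zero    = zero
double (suc n) = suc (suc (double n))

2∣double : ∀ n → 2 ∣ double n
2∣double zero = divides 0 refl
2∣double (suc n) with 2∣double n
... | divides q p = divides (suc q) (cong (λ m → suc (suc m)) p)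

-- `Cyc 0` is K2. The parity of the position is a 2-colouring because the length `double (suc n)` is
-- even, so that the reduction modulo the length preserves it.
even-cycle⇒edge : ∀ n → Hom (Cyc (double n)) (Cyc 0)
even-cycle⇒edge n = labelling⇒hom {G = Cyc (double n)} (toℕ , λ x y xy →
  ⊎-map (parity x y) (parity y x) (Cyc-edge⁻ x y xy))
  where
  parity : ∀ x y → next x ≡ y → Cong 2 (toℕ y) (suc (toℕ x))
  parity x y refl = residues (trans (cong (_% 2) (toℕ-fromℕ< (m%n<n (suc (toℕ x)) (double (suc n)))))
    (m∣n⇒o%n%m≡o%m 2 (double (suc n)) (suc (toℕ x)) (2∣double (suc n))))

-- Cycles are outerplanar

iter : {A : Set} → (A → A) → ℕ → A → A
iter f zero    x = x
iter f (suc t) x = f (iter f t x)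

-- A connected set has at most two neighbours outside it: the points at which
-- the two walks around the cycle from a chosen element first leave it.
module _ {X : Set} (A : X → Set) (a : X) where

  Stays Exit : (X → X) → ℕ → Set
  Stays f t = ∀ i → i ≤ t → A (iter f i a)
  Exit f t = Stays f t × ¬ A (iter f (suc t) a)

  exit-unique : ∀ {f s t} → Exit f s → Exit f t → s ≡ t
  exit-unique {f} {s} {t} (p , ¬p) (q , ¬q) with <-cmp s t
  ... | tri< s<t _ _ = ⊥-elim (¬p (q (suc s) s<t))
  ... | tri≈ _ s≡t _ = s≡t
  ... | tri> _ _ t<s = ⊥-elim (¬q (p (suc t) t<s))

  Stays-suc : ∀ {f t} → Stays f t → A (iter f (suc t) a) → Stays f (suc t)
  Stays-suc {f} {t} p q i i≤ with ℕₚ.m≤n⇒m<n∨m≡n i≤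
  ... | inj₁ i< = p i (s≤s⁻¹ i<)
  ... | inj₂ refl = q

  Stays-pred : ∀ {f t} → Stays f (suc t) → Stays f t
  Stays-pred p i i≤ = p i (≤-trans i≤ (n≤1+n _))

  RunOf : (X → X) → X → Set
  RunOf f x = ∃[ t ] (Stays f t × iter f t a ≡ x)

  ExitOf : (X → X) → X → Set
  ExitOf f x = ∃[ t ] (Exit f t × iter f (suc t) a ≡ x)

  forward : ∀ f {x} → RunOf f x → A (f x) → RunOf f (f x)
  forward f (t , p , refl) q = suc t , Stays-suc {f} p q , refl

  forward-exit : ∀ f {x} → RunOf f x → ¬ A (f x) → ExitOf f (f x)
  forward-exit f (t , p , refl) q = t , (p , q) , refl

  module _ (f g : X → X) (g∘f : ∀ x → g (f x) ≡ x) where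

    -- A step against the direction of a run undoes its last step; if the run is still at `a`, it
    -- begins a run in the other direction.
    backward : A a → ∀ {x} → RunOf f x → A (g x) → RunOf f (g x) ⊎ RunOf g (g x)
    backward Aa (zero , p , refl) q = inj₂ (1 , (λ { zero _ → Aa ; (suc zero) _ → q ; (suc (suc _)) (s≤s ()) }) , refl)
    backward Aa (suc t , p , refl) q = inj₁ (t , Stays-pred {f} p , ≡-sym (g∘f _))

    backward-exit : ∀ {x} → RunOf f x → ¬ A (g x) → ExitOf g (g x)
    backward-exit (zero , p , refl) q = 0 , ((λ { zero z≤n → p zero z≤n }) , q) , refl
    backward-exit (suc t , p , refl) q = ⊥-elim (q (subst A (≡-sym (g∘f _)) (p t (n≤1+n t))))

ExitOf-unique : ∀ {X : Set} (A : X → Set) a f {x y} → ExitOf A a f x → ExitOf A a f y → x ≡ y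
ExitOf-unique A a f (s , p , refl) (t , q , refl) = cong (λ i → iter f (suc i) a) (exit-unique A a {f} p q)

module _ {M : ℕ} {A : Vertex (Cyc M) → Set} where

  private
    neighbour : ∀ x y → Edge (Cyc M) x y → (y ≡ next x) ⊎ (y ≡ prev x)
    neighbour x y xy with Cyc-edge⁻ x y xy
    ... | inj₁ p = inj₁ (≡-sym p)
    ... | inj₂ p = inj₂ (trans (≡-sym (unshift-shift 1 y)) (cong prev p))

  reach-start : ∀ {a x} → ReachIn (Cyc M) A a x → A a
  reach-start (here p) = p
  reach-start (step r _ _) = reach-start r

  reach⇒run : ∀ {a x} → ReachIn (Cyc M) A a x → RunOf A a next x ⊎ RunOf A a prev x
  reach⇒run (here p) = inj₁ (0 , (λ { zero _ → p }) , refl)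
  reach⇒run {a} (step {y = y} {z} r e q) with reach⇒run r | neighbour y z e
  ... | inj₁ run | inj₁ refl = inj₁ (forward A a next run q)
  ... | inj₁ run | inj₂ refl = backward A a next prev (unshift-shift 1) (reach-start r) run q
  ... | inj₂ run | inj₂ refl = inj₂ (forward A a prev run q)
  ... | inj₂ run | inj₁ refl = ⊎-swap (backward A a prev next (shift-unshift 1) (reach-start r) run q)

  neighbour-exit : ∀ {a x y} → ReachIn (Cyc M) A a x → Edge (Cyc M) x y → ¬ A y → ExitOf A a next y ⊎ ExitOf A a prev y
  neighbour-exit {a} {x} {y} r e q with reach⇒run r | neighbour x y e
  ... | inj₁ run | inj₁ refl = inj₁ (forward-exit A a next run q)
  ... | inj₁ run | inj₂ refl = inj₂ (backward-exit A a next prev (unshift-shift 1) run q)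
  ... | inj₂ run | inj₂ refl = inj₂ (forward-exit A a prev run q)
  ... | inj₂ run | inj₁ refl = inj₁ (backward-exit A a prev next (shift-unshift 1) run q)

-- Each neighbour of `h` has a branch set containing an exit point of the branch set of `h`. There
-- is at most one exit point in each of the two directions, so two of the three neighbours would
-- coincide.
Cyc-no-claw : ∀ {M H} (h h₁ h₂ h₃ : Vertex H) → h₁ ≢ h₂ → h₁ ≢ h₃ → h₂ ≢ h₃ →
              Edge H h h₁ → Edge H h h₂ → Edge H h h₃ → ¬ IsMinorOf H (Cyc M)
Cyc-no-claw {M} {H} h h₁ h₂ h₃ d₁₂ d₁₃ d₂₃ e₁ e₂ e₃ m = clash (exit h₁ e₁) (exit h₂ e₂) (exit h₃ e₃)
  where
  open MinorModel m
  A : Vertex (Cyc M) → Set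
  A g = branch g ≡ just h
  a : Vertex (Cyc M)
  a = proj₁ (nonempty h)
  Boundary : Vertex H → (Vertex (Cyc M) → Vertex (Cyc M)) → Set
  Boundary k f = ∃[ y ] (branch y ≡ just k × ExitOf A a f y)
  exit : ∀ k → Edge H h k → Boundary k next ⊎ Boundary k prev
  exit k hk with edges h k hk
  ... | x , y , bx , by , xy with neighbour-exit (connected h a x (proj₂ (nonempty h)) bx) xy outside
    where
    outside : branch y ≢ just h
    outside p with just-injective (trans (≡-sym by) p)
    ... | refl with () ← trans (≡-sym hk) (irrefl H h)
  ... | inj₁ z = inj₁ (y , by , z)
  ... | inj₂ z = inj₂ (y , by , z)
  same : ∀ f {k l} → Boundary k f → Boundary l f → k ≡ l
  same f (y , p , q) (z , r , s) = just-injective (trans (≡-sym p) (trans (cong branch (ExitOf-unique A a f q s)) r))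
  clash : Boundary h₁ next ⊎ Boundary h₁ prev → Boundary h₂ next ⊎ Boundary h₂ prev → Boundary h₃ next ⊎ Boundary h₃ prev → ⊥
  clash (inj₁ p) (inj₁ q) r = d₁₂ (same next p q)
  clash (inj₂ p) (inj₂ q) r = d₁₂ (same prev p q)
  clash (inj₁ p) (inj₂ q) (inj₁ r) = d₁₃ (same next p r)
  clash (inj₁ p) (inj₂ q) (inj₂ r) = d₂₃ (same prev q r)
  clash (inj₂ p) (inj₁ q) (inj₁ r) = d₂₃ (same next q r)
  clash (inj₂ p) (inj₁ q) (inj₂ r) = d₁₃ (same prev p r)

Cyc-outerplanar : ∀ M → Outerplanar (Cyc M)
Cyc-outerplanar M =
  Cyc-no-claw {H = K4} zero (suc zero) (suc (suc zero)) (suc (suc (suc zero))) (λ ()) (λ ()) (λ ()) refl refl refl ,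
  Cyc-no-claw {H = K23} zero (suc (suc zero)) (suc (suc (suc zero))) (suc (suc (suc (suc zero)))) (λ ()) (λ ()) (λ ()) refl refl refl

-- Long cycles satisfy the same sentences

edge? : ∀ G x y → Dec (Edge G x y)
edge? G x y = adj G x y ≟ᵇ true

Sat? : ∀ {k} G (φ : Formula k) ρ → Dec (Sat G φ ρ)
Sat? G tt        ρ = yes tt
Sat? G ff        ρ = no λ ()
Sat? G (E i j)   ρ = edge? G (ρ i) (ρ j)
Sat? G (Eq i j)  ρ = ρ i ≟ ρ j
Sat? G (neg φ)   ρ = ¬? (Sat? G φ ρ)
Sat? G (φ and ψ) ρ = Sat? G φ ρ ×-dec Sat? G ψ ρ
Sat? G (φ or ψ)  ρ = Sat? G φ ρ ⊎-dec Sat? G ψ ρ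
Sat? G (ex φ)    ρ = any? λ v → Sat? G φ (extend v ρ)
Sat? G (all φ)   ρ = all? λ v → Sat? G φ (extend v ρ)

rank : ∀ {k} → Formula k → ℕ
rank tt        = 0
rank ff        = 0
rank (E i j)   = 0
rank (Eq i j)  = 0
rank (neg φ)   = rank φ
rank (φ and ψ) = rank φ ⊔ rank ψ
rank (φ or ψ)  = rank φ ⊔ rank ψ
rank (ex φ)    = suc (rank φ)
rank (all φ)   = suc (rank φ)

missed : ∀ {m n} → m < n → (g : Fin m → Fin n) → ∃[ y ] (∀ i → g i ≢ y)
missed {m} {n} m<n g with any? (λ y → ¬? (any? λ i → g i ≟ y))
... | yes (y , p) = y , λ i q → p (i , q)
... | no ¬p = contradiction (injective⇒≤ {f = λ y → proj₁ (hit y)} hit-injective) (ℕₚ.<⇒≱ m<n)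
  where
  hit : ∀ y → ∃[ i ] (g i ≡ y)
  hit y with any? (λ i → g i ≟ y)
  ... | yes q = q
  ... | no ¬q = ⊥-elim (¬p (y , ¬q))
  hit-injective : ∀ {x y} → proj₁ (hit x) ≡ proj₁ (hit y) → x ≡ y
  hit-injective {x} {y} p = trans (≡-sym (proj₂ (hit x))) (trans (cong g p) (proj₂ (hit y)))

data IsNear {M : ℕ} (R : ℕ) (x y : Fin (suc M)) : Set where
  ahead  : ∀ d → d ≤ R → shift d x ≡ y → IsNear R x y
  behind : ∀ d → d ≤ R → shift d y ≡ x → IsNear R x y

isNear? : ∀ {M} R (x y : Fin (suc M)) → Dec (IsNear R x y)
isNear? R x y = map′ to from ((any? λ d → shift (toℕ d) x ≟ y) ⊎-dec (any? λ d → shift (toℕ d) y ≟ x))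
  where
  to : (∃[ d ] (shift (toℕ {suc R} d) x ≡ y)) ⊎ (∃[ d ] (shift (toℕ {suc R} d) y ≡ x)) → IsNear R x y
  to (inj₁ (d , p)) = ahead (toℕ d) (s≤s⁻¹ (toℕ<n d)) p
  to (inj₂ (d , p)) = behind (toℕ d) (s≤s⁻¹ (toℕ<n d)) p
  from : IsNear R x y → (∃[ d ] (shift (toℕ {suc R} d) x ≡ y)) ⊎ (∃[ d ] (shift (toℕ {suc R} d) y ≡ x))
  from (ahead d d≤R p) = inj₁ (fromℕ< (s≤s d≤R) , trans (cong (λ c → shift c x) (toℕ-fromℕ< (s≤s d≤R))) p)
  from (behind d d≤R p) = inj₂ (fromℕ< (s≤s d≤R) , trans (cong (λ c → shift c y) (toℕ-fromℕ< (s≤s d≤R))) p)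

far-point : ∀ {M k} R (a : Fin k → Fin (suc M)) → k * suc (R + R) < suc M → ∃[ y ] (∀ i → ¬ IsNear R (a i) y)
far-point {M} {k} R a big = proj₁ missing , far
  where
  -- The points near x are those between R steps behind and R steps ahead of it.
  around : Fin k × Fin (suc (R + R)) → Fin (suc M)
  around (i , d) = shift (toℕ d) (unshift R (a i))
  missing : ∃[ y ] (∀ c → around (remQuot {k} _ c) ≢ y)
  missing = missed big (λ c → around (remQuot {k} _ c))
  misses : ∀ i d → d ≤ R + R → shift d (unshift R (a i)) ≢ proj₁ missing
  misses i d d≤ p = proj₂ missing (combine i δ) (trans (cong around (remQuot-combine {k} i δ))
    (trans (cong (λ c → shift c (unshift R (a i))) (toℕ-fromℕ< (s≤s d≤))) p))
    where
    δ : Fin (suc (R + R))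
    δ = fromℕ< (s≤s d≤)
  far : ∀ i → ¬ IsNear R (a i) (proj₁ missing)
  far i (ahead d d≤R p) = misses i (d + R) (+-mono-≤ d≤R ≤-refl)
    (trans (≡-sym (shift-shift d R _)) (trans (cong (shift d) (shift-unshift R (a i))) p))
  far i (behind d d≤R p) = misses i (R ∸ d) (≤-trans (ℕₚ.m∸n≤m R d) (m≤m+n R R)) (shift-injective d (trans
    (shift-shift d (R ∸ d) _) (trans (cong (λ c → shift c (unshift R (a i))) (m+[n∸m]≡n d≤R)) (trans (shift-unshift R (a i)) (≡-sym p)))))

-- The invariant of the Ehrenfeucht-Fraïssé game on two cycles: directed offsets up to `R` are
-- carried over. Offset 0 is equality and offset 1 is the successor relation.
Follows : ∀ {k M M′} → ℕ → (Fin k → Fin (suc M)) → (Fin k → Fin (suc M′)) → Set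
Follows R a b = ∀ i j d → d ≤ R → shift d (a i) ≡ a j → shift d (b i) ≡ b j

module _ {k M M′ R : ℕ} {a : Fin k → Fin (suc M)} {b : Fin k → Fin (suc M′)} where

  -- A shift by fewer steps than the length fixes a point only if it is the shift by 0. Without
  -- `R < suc M` an offset could wind around the first cycle.
  follows-self : ∀ {x} (y : Fin (suc M′)) → R < suc M → ∀ e → e ≤ R → shift e x ≡ x → shift e y ≡ y
  follows-self y R< e e≤R p rewrite shift-free (≤-<-trans e≤R R<) p = shift-zero y

  follows-difference : Follows (R + R) a b → ∀ i j {d e} → d ≤ R → e ≤ R →
                       shift d (a i) ≡ shift e (a j) → shift d (b i) ≡ shift e (b j)
  follows-difference F i j {d} {e} d≤R e≤R p with ℕₚ.≤-total d e
  ... | inj₁ d≤e = ≡-sym (trans (shift-split (b j)) (cong (shift d) (F j i (e ∸ d) (≤-trans (ℕₚ.m∸n≤m e d) (≤-trans e≤R (m≤m+n R R)))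
                     (shift-injective d (trans (≡-sym (shift-split (a j))) (≡-sym p))))))
    where
    shift-split : ∀ {L} (x : Fin (suc L)) → shift e x ≡ shift d (shift (e ∸ d) x)
    shift-split x = trans (cong (λ c → shift c x) (≡-sym (m+[n∸m]≡n d≤e))) (≡-sym (shift-shift d (e ∸ d) x))
  ... | inj₂ e≤d = trans (shift-split (b i)) (cong (shift e) (F i j (d ∸ e) (≤-trans (ℕₚ.m∸n≤m d e) (≤-trans d≤R (m≤m+n R R)))
                     (shift-injective e (trans (≡-sym (shift-split (a i))) p))))
    where
    shift-split : ∀ {L} (x : Fin (suc L)) → shift d x ≡ shift e (shift (d ∸ e) x)
    shift-split x = trans (cong (λ c → shift c x) (≡-sym (m+[n∸m]≡n e≤d))) (≡-sym (shift-shift e (d ∸ e) x))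

  extend-ahead : Follows (R + R) a b → R < suc M → ∀ i {d x y} → d ≤ R → shift d (a i) ≡ x → shift d (b i) ≡ y →
                 Follows R (extend x a) (extend y b)
  extend-ahead F R< i d≤R refl refl zero zero e e≤R p = follows-self _ R< e e≤R p
  extend-ahead F R< i {d} d≤R refl refl zero (suc j) e e≤R p = trans (shift-shift e d (b i))
    (F i j (e + d) (+-mono-≤ e≤R d≤R) (trans (≡-sym (shift-shift e d (a i))) p))
  extend-ahead F R< i d≤R refl refl (suc j) zero e e≤R p = follows-difference F j i e≤R d≤R p
  extend-ahead F R< i d≤R refl refl (suc j) (suc l) e e≤R p = F j l e (≤-trans e≤R (m≤m+n R R)) p

  extend-behind : Follows (R + R) a b → R < suc M → ∀ i {d x y} → d ≤ R → shift d x ≡ a i → shift d y ≡ b i →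
                  Follows R (extend x a) (extend y b)
  extend-behind F R< i d≤R q r zero zero e e≤R p = follows-self _ R< e e≤R p
  extend-behind F R< i {d} {x} {y} d≤R q r zero (suc j) e e≤R p = shift-injective d
    (trans (shift-comm d e y) (trans (cong (shift e) r)
      (follows-difference F i j e≤R d≤R (trans (cong (shift e) (≡-sym q)) (trans (shift-comm e d x) (cong (shift d) p))))))
  extend-behind F R< i {d} {x} {y} d≤R q r (suc j) zero e e≤R p = shift-injective d
    (trans (shift-shift d e (b j)) (trans (F j i (d + e) (+-mono-≤ d≤R e≤R)
      (trans (≡-sym (shift-shift d e (a j))) (trans (cong (shift d) p) q))) (≡-sym r)))
  extend-behind F R< i d≤R q r (suc j) (suc l) e e≤R p = F j l e (≤-trans e≤R (m≤m+n R R)) p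

  extend-far : Follows (R + R) a b → R < suc M → ∀ {x} y → (∀ i → ¬ IsNear R (a i) x) →
               Follows R (extend x a) (extend y b)
  extend-far F R< y far zero zero e e≤R p = follows-self y R< e e≤R p
  extend-far F R< y far zero (suc j) e e≤R p = ⊥-elim (far j (behind e e≤R p))
  extend-far F R< y far (suc j) zero e e≤R p = ⊥-elim (far j (ahead e e≤R p))
  extend-far F R< y far (suc j) (suc l) e e≤R p = F j l e (≤-trans e≤R (m≤m+n R R)) p

Similar : ∀ {k M M′} → ℕ → (Fin k → Fin (suc M)) → (Fin k → Fin (suc M′)) → Set
Similar R a b = Follows R a b × Follows R b a

-- The duplicator's move: a point close to an earlier one is answered at the same offset from its
-- counterpart, and a point far from all earlier ones by any far point of the other cycle, which is
-- long enough to have one.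
respond : ∀ {k M M′ R} {a : Fin k → Fin (suc M)} {b : Fin k → Fin (suc M′)} →
          R < suc M → R < suc M′ → k * suc (R + R) < suc M′ →
          Similar (R + R) a b → ∀ x → ∃[ y ] Similar R (extend x a) (extend y b)
respond {R = R} {a} {b} R< R<′ big (F , F′) x with any? (λ i → isNear? R (a i) x)
... | yes (i , ahead d d≤R p) =
  shift d (b i) , extend-ahead F R< i d≤R p refl , extend-ahead F′ R<′ i d≤R refl p
... | yes (i , behind d d≤R p) =
  unshift d (b i) , extend-behind F R< i d≤R p (shift-unshift d (b i)) , extend-behind F′ R<′ i d≤R (shift-unshift d (b i)) p
... | no far with far-point R b big
... | y , far′ = y , extend-far F R< y (λ i p → far (i , p)) , extend-far F′ R<′ x far′

-- With `r` rounds left, offsets up to `radius r` are controlled. A new point within `R` of an old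
-- one needs its own offsets up to `R` controlled, hence offsets up to `R + R` between the old ones.
-- At the end radius 1 is left, enough for adjacency.
radius : ℕ → ℕ
radius zero    = 1
radius (suc r) = radius r + radius r

radius-mono : ∀ {r s} → r ≤ s → radius r ≤ radius s
radius-mono {s = zero} z≤n = ≤-refl
radius-mono {s = suc s} z≤n = ≤-trans (radius-mono {s = s} z≤n) (m≤m+n _ _)
radius-mono (s≤s p) = +-mono-≤ (radius-mono p) (radius-mono p)

-- At most `q` points are ever chosen and each has at most `2 * radius q + 1` points near it. On a
-- longer cycle a far point exists in every round.
threshold : ℕ → ℕ
threshold q = q * suc (radius q + radius q)

module _ (q : ℕ) where

  private
    radius-bound : ∀ {k r n} → k + suc r ≤ q → threshold q < n → radius r < n
    radius-bound {k} {r} {n} p big = ≤-<-trans (≤-trans (radius-mono r≤q) (≤-trans (m≤m+n _ _)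
      (≤-trans (n≤1+n _) (ℕₚ.m≤n*m _ q {{>-nonZero (≤-<-trans z≤n r<q)}})))) big
      where
      r<q : r < q
      r<q = ≤-trans (m≤n+m (suc r) k) p
      r≤q : r ≤ q
      r≤q = ℕₚ.<⇒≤ r<q

    tuple-bound : ∀ {k r n} → k + suc r ≤ q → threshold q < n → k * suc (radius r + radius r) < n
    tuple-bound {k} {r} p big = ≤-<-trans (ℕₚ.*-mono-≤ (≤-trans (m≤m+n k (suc r)) p)
      (s≤s (+-mono-≤ (radius-mono r≤q) (radius-mono r≤q)))) big
      where
      r≤q : r ≤ q
      r≤q = ≤-trans (≤-trans (n≤1+n r) (m≤n+m (suc r) k)) p

  -- Here `k` points are chosen and `r` rounds remain; keeping `k + r` below `q` lets one length
  -- bound serve all rounds.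
  transfer : ∀ {k M M′} r (φ : Formula k) → rank φ ≤ r → k + r ≤ q → threshold q < suc (suc M) → threshold q < suc (suc M′) →
             {a : Fin k → Vertex (Cyc M)} {b : Fin k → Vertex (Cyc M′)} → Similar (radius r) a b →
             (Sat (Cyc M) φ a → Sat (Cyc M′) φ b) × (Sat (Cyc M′) φ b → Sat (Cyc M) φ a)
  transfer r tt φ≤ kr big big′ S = id , id
  transfer r ff φ≤ kr big big′ S = id , id
  transfer r (E i j) φ≤ kr big big′ {a} {b} (F , F′) = edge F , edge F′
    where
    edge : ∀ {M M′} {a : Fin _ → Vertex (Cyc M)} {b : Fin _ → Vertex (Cyc M′)} → Follows (radius r) a b →
           Edge (Cyc M) (a i) (a j) → Edge (Cyc M′) (b i) (b j)
    edge {a = a} {b} F e = Cyc-edge⁺ (b i) (b j) (⊎-map (F i j 1 (radius-mono {s = r} z≤n)) (F j i 1 (radius-mono {s = r} z≤n))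
      (Cyc-edge⁻ (a i) (a j) e))
  transfer r (Eq i j) φ≤ kr big big′ {a} {b} (F , F′) = equal F , equal F′
    where
    equal : ∀ {M M′} {a : Fin _ → Vertex (Cyc M)} {b : Fin _ → Vertex (Cyc M′)} → Follows (radius r) a b →
            a i ≡ a j → b i ≡ b j
    equal {a = a} {b} F e = trans (≡-sym (shift-zero (b i))) (F i j 0 z≤n (trans (shift-zero (a i)) e))
  transfer r (neg φ) φ≤ kr big big′ S with transfer r φ φ≤ kr big big′ S
  ... | to , from = (λ p q → p (from q)) , (λ p q → p (to q))
  transfer r (φ and ψ) φ≤ kr big big′ S
    with transfer r φ (≤-trans (ℕₚ.m≤m⊔n _ _) φ≤) kr big big′ S | transfer r ψ (≤-trans (ℕₚ.m≤n⊔m (rank φ) _) φ≤) kr big big′ S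
  ... | to , from | to′ , from′ = (λ (p , q) → to p , to′ q) , (λ (p , q) → from p , from′ q)
  transfer r (φ or ψ) φ≤ kr big big′ S
    with transfer r φ (≤-trans (ℕₚ.m≤m⊔n _ _) φ≤) kr big big′ S | transfer r ψ (≤-trans (ℕₚ.m≤n⊔m (rank φ) _) φ≤) kr big big′ S
  ... | to , from | to′ , from′ = ⊎-map to to′ , ⊎-map from from′
  transfer {k} (suc r) (ex φ) (s≤s φ≤) kr big big′ S = to , from
    where
    kr′ : suc k + r ≤ q
    kr′ = subst (_≤ q) (+-suc k r) kr
    to : _
    to (x , p) with respond (radius-bound {k} kr big) (radius-bound {k} kr big′) (tuple-bound {k} kr big′) S x
    ... | y , S′ = y , proj₁ (transfer r φ φ≤ kr′ big big′ S′) p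
    from : _
    from (y , p) with respond (radius-bound {k} kr big′) (radius-bound {k} kr big) (tuple-bound {k} kr big) (swap S) y
    ... | x , S′ = x , proj₂ (transfer r φ φ≤ kr′ big big′ (swap S′)) p
  transfer {k} (suc r) (all φ) (s≤s φ≤) kr big big′ S = to , from
    where
    kr′ : suc k + r ≤ q
    kr′ = subst (_≤ q) (+-suc k r) kr
    to : _
    to h y with respond (radius-bound {k} kr big′) (radius-bound {k} kr big) (tuple-bound {k} kr big) (swap S) y
    ... | x , S′ = proj₁ (transfer r φ φ≤ kr′ big big′ (swap S′)) (h x)
    from : _
    from h x with respond (radius-bound {k} kr big) (radius-bound {k} kr big′) (tuple-bound {k} kr big′) S x
    ... | y , S′ = proj₂ (transfer r φ φ≤ kr′ big big′ S′) (h y)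

long-cycles-agree : ∀ (φ : Sentence) M M′ → threshold (rank φ) ≤ M → threshold (rank φ) ≤ M′ → Cyc M ⊨ φ → Cyc M′ ⊨ φ
long-cycles-agree φ M M′ big big′ = proj₁ (transfer (rank φ) (rank φ) φ ≤-refl ≤-refl (m≤n⇒m≤1+n (s≤s big)) (m≤n⇒m≤1+n (s≤s big′))
  {emptyEnv (Cyc M)} {emptyEnv (Cyc M′)} ((λ ()) , (λ ())))
  where open ℕₚ using (m≤n⇒m≤1+n)

-- Walks and components

data Walk (G : Graph) : ℕ → Vertex G → Vertex G → Set where
  nil  : ∀ {x} → Walk G 0 x x
  cons : ∀ {n x} y {z} → Edge G x y → Walk G n y z → Walk G (suc n) x z

walk? : ∀ G n x y → Dec (Walk G n x y)
walk? G zero x y = map′ (λ { refl → nil }) (λ { nil → refl }) (x ≟ y)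
walk? G (suc n) x z = map′ (λ (y , e , w) → cons y e w) (λ { (cons y e w) → y , e , w })
  (any? λ y → edge? G x y ×-dec walk? G n y z)

edge-sym : ∀ G {x y} → Edge G x y → Edge G y x
edge-sym G {x} {y} e = trans (sym G y x) e

no-loop : ∀ G {x} → ¬ Edge G x x
no-loop G {x} e with () ← trans (≡-sym e) (irrefl G x)

module _ {G : Graph} where

  _++_ : ∀ {m n x y z} → Walk G m x y → Walk G n y z → Walk G (m + n) x z
  nil ++ w = w
  cons y e v ++ w = cons y e (v ++ w)

  snoc : ∀ {n x y z} → Walk G n x y → Edge G y z → Walk G (suc n) x z
  snoc nil e = cons _ e nil
  snoc (cons y f w) e = cons y f (snoc w e)

  reverse : ∀ {n x y} → Walk G n x y → Walk G n y x
  reverse nil = nil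
  reverse (cons y e w) = snoc (reverse w) (edge-sym G e)

  module _ {S : Vertex G → Set} where

    reach⇒walk : ∀ {x y} → ReachIn G S x y → ∃[ n ] Walk G n x y
    reach⇒walk (here _) = 0 , nil
    reach⇒walk (step r e _) = suc (proj₁ (reach⇒walk r)) , snoc (proj₂ (reach⇒walk r)) e

    reach-end : ∀ {x y} → ReachIn G S x y → S y
    reach-end (here p) = p
    reach-end (step _ _ p) = p

    reach-trans : ∀ {x y z} → ReachIn G S x y → ReachIn G S y z → ReachIn G S x z
    reach-trans r (here _) = r
    reach-trans r (step s e p) = step (reach-trans r s) e p

    reach-sym : ∀ {x y} → ReachIn G S x y → ReachIn G S y x
    reach-sym (here p) = here p
    reach-sym (step r e p) = reach-trans (step (here p) (edge-sym G e) (reach-end r)) (reach-sym r)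

reach-map : ∀ {G G′} {S : Vertex G → Set} {S′ : Vertex G′ → Set} (f : Vertex G → Vertex G′) →
            (∀ x → S x → S′ (f x)) → (∀ x y → Edge G x y → Edge G′ (f x) (f y)) →
            ∀ {x y} → ReachIn G S x y → ReachIn G′ S′ (f x) (f y)
reach-map f s e (here p) = here (s _ p)
reach-map f s e (step r xy p) = step (reach-map f s e r) (e _ _ xy) (s _ p)

walk-map : ∀ {G G′} (f : Vertex G → Vertex G′) → (∀ x y → Edge G x y → Edge G′ (f x) (f y)) →
           ∀ {n x y} → Walk G n x y → Walk G′ n (f x) (f y)
walk-map f e nil = nil
walk-map f e (cons y xy w) = cons (f y) (e _ _ xy) (walk-map f e w)

∧-true : ∀ {a b} → a ∧ b ≡ true → (a ≡ true) × (b ≡ true)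
∧-true {true} p = refl , p

∧-intro : ∀ {a b} → a ≡ true → b ≡ true → a ∧ b ≡ true
∧-intro refl refl = refl

true-or-false : ∀ b → (b ≡ true) ⊎ (b ≡ false)
true-or-false true  = inj₁ refl
true-or-false false = inj₂ refl

true≢false : ∀ {b} → b ≡ true → b ≢ false
true≢false refl ()

count : ∀ {n} → (Fin n → Bool) → ℕ
count {zero}  p = 0
count {suc n} p = (if p zero then 1 else 0) + count (p ∘ suc)

indicator-mono : ∀ {a b} → (a ≡ true → b ≡ true) → (if a then 1 else 0) ≤ (if b then 1 else 0)
indicator-mono {false} h = z≤n
indicator-mono {true} h rewrite h refl = ≤-refl

count-mono : ∀ {n} {p q : Fin n → Bool} → (∀ x → p x ≡ true → q x ≡ true) → count p ≤ count q
count-mono {zero} h = z≤n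
count-mono {suc n} h = +-mono-≤ (indicator-mono (h zero)) (count-mono (h ∘ suc))

count-< : ∀ {n} {p q : Fin n → Bool} → (∀ x → p x ≡ true → q x ≡ true) →
          ∀ z → p z ≡ false → q z ≡ true → count p < count q
count-< h zero pz qz rewrite pz | qz = s≤s (count-mono (h ∘ suc))
count-< {p = p} {q} h (suc z) pz qz =
  subst (_≤ count q) (+-suc (if p zero then 1 else 0) _) (+-mono-≤ (indicator-mono (h zero)) (count-< (h ∘ suc) z pz qz))

-- `reach` stays within `set` itself and not merely within `P`, so that a region can serve as a
-- branch set of a minor.
record Region (G : Graph) (P : Vertex G → Bool) (d : Vertex G) : Set where
  field
    set    : Vertex G → Bool
    root   : set d ≡ true
    inside : ∀ x → set x ≡ true → P x ≡ true
    reach  : ∀ x → set x ≡ true → ReachIn G (λ y → set y ≡ true) d x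

record Component (G : Graph) (P : Vertex G → Bool) (d : Vertex G) : Set where
  field
    region : Region G P d
    closed : ∀ x y → Region.set region x ≡ true → Edge G x y → P y ≡ true → Region.set region y ≡ true
  open Region region public

module _ {G : Graph} {P : Vertex G → Bool} {d : Vertex G} where

  -- `m` bounds the number of vertices not yet in the region; each vertex added lowers that number.
  grow : ∀ m (r : Region G P d) → count (not ∘ Region.set r) ≤ m → Component G P d
  grow m r bound with any? (λ x → any? λ y → (Region.set r x ≟ᵇ true) ×-dec (edge? G x y ×-dec ((P y ≟ᵇ true) ×-dec (Region.set r y ≟ᵇ false))))
  ... | no stuck = record { region = r ; closed = closed }
    where
    closed : _
    closed x y rx xy Py with true-or-false (Region.set r y)
    ... | inj₁ ry = ry
    ... | inj₂ ¬ry = ⊥-elim (stuck (x , y , rx , xy , Py , ¬ry))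
  ... | yes (x , y , rx , xy , Py , ¬ry) = continue m bound
    where
    open Region r
    set′ : Vertex G → Bool
    set′ z = set z ∨ does (z ≟ y)
    old : ∀ z → set z ≡ true → set′ z ≡ true
    old z p rewrite p = refl
    new : set′ y ≡ true
    new = trans (cong (set y ∨_) (dec-true (y ≟ y) refl)) (∨-zeroʳ (set y))
    cases : ∀ z → set′ z ≡ true → (set z ≡ true) ⊎ (z ≡ y)
    cases z p = ⊎-map id (does-true {d = z ≟ y}) (∨-true p)
    reach-old : ∀ z → set z ≡ true → ReachIn G (λ v → set′ v ≡ true) d z
    reach-old z p = reach-map id old (λ _ _ → id) (reach z p)
    r′ : Region G P d
    r′ = record
      { set = set′
      ; root = old d root
      ; inside = λ z p → [ inside z , (λ { refl → Py }) ]′ (cases z p)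
      ; reach = λ z p → [ reach-old z , (λ { refl → step (reach-old x rx) xy new }) ]′ (cases z p)
      }
    shrinks : count (not ∘ set′) < count (not ∘ set)
    shrinks = count-< fewer y (cong not new) (cong not ¬ry)
      where
      fewer : ∀ z → not (set′ z) ≡ true → not (set z) ≡ true
      fewer z p with set z
      ... | false = refl
    continue : ∀ m → count (not ∘ set) ≤ m → Component G P d
    continue zero b with () ← <-≤-trans shrinks b
    continue (suc m) b = grow m r′ (s≤s⁻¹ (<-≤-trans shrinks b))

component : ∀ G (P : Vertex G → Bool) d → P d ≡ true → Component G P d
component G P d Pd = grow _ singleton ≤-refl
  where
  singleton : Region G P d
  singleton = record
    { set = λ z → does (d ≟ z)
    ; root = dec-true (d ≟ d) refl
    ; inside = λ z p → subst (λ v → P v ≡ true) (does-true {d = d ≟ z} p) Pd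
    ; reach = λ z p → subst (ReachIn G _ d) (does-true {d = d ≟ z} p) (here (dec-true (d ≟ d) refl))
    }

-- Two-colourings and odd closed walks

odd : ℕ → Bool
odd zero    = false
odd (suc n) = not (odd n)

odd-+ : ∀ m n → odd (m + n) ≡ odd m xor odd n
odd-+ zero n = refl
odd-+ (suc m) n = trans (cong not (odd-+ m n)) (not-xor (odd m) (odd n))
  where
  not-xor : ∀ a b → not (a xor b) ≡ not a xor b
  not-xor true true = refl
  not-xor true false = refl
  not-xor false b = refl

odd-double : ∀ n → odd (double n) ≡ false
odd-double zero = refl
odd-double (suc n) = cong (not ∘ not) (odd-double n)

odd⇒suc-double : ∀ n → odd n ≡ true → ∃[ j ] (n ≡ suc (double j))
odd⇒suc-double (suc zero) p = 0 , refl
odd⇒suc-double (suc (suc n)) p with odd⇒suc-double n (trans (≡-sym (not-not (odd n))) p)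
  where
  not-not : ∀ b → not (not b) ≡ b
  not-not true = refl
  not-not false = refl
... | j , q = suc j , cong (λ i → suc (suc i)) q

first : ∀ {n} → (Fin n → Bool) → Maybe (Fin n)
first {zero}  p = nothing
first {suc n} p = if p zero then just zero else Data.Maybe.map suc (first (p ∘ suc))

-- Components computed from adjacent vertices are known to agree only pointwise. This suffices for
-- them to have the same base vertex.
first-cong : ∀ {n} {p q : Fin n → Bool} → (∀ x → p x ≡ q x) → first p ≡ first q
first-cong {zero} h = refl
first-cong {suc n} h rewrite h zero | first-cong (h ∘ suc) = refl

first-found : ∀ {n} (p : Fin n → Bool) {x} → p x ≡ true → ∃[ y ] (first p ≡ just y × p y ≡ true)
first-found {suc n} p {x} px with p zero in eq
... | true = zero , refl , eq
first-found {suc n} p {zero} px | false with () ← trans (≡-sym px) eq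
first-found {suc n} p {suc x} px | false with first-found (p ∘ suc) {x} px
... | y , q , py rewrite q = suc y , refl , py

OddClosedWalk : Graph → ℕ → Set
OddClosedWalk G j = ∃[ x ] Walk G (suc (double j)) x x

-- A vertex is coloured by the parity of a walk to the least vertex of its component.
two-colouring-or-odd-walk : ∀ G → (Σ (Vertex G → Bool) λ c → ∀ x y → Edge G x y → c x ≢ c y) ⊎ ∃ (OddClosedWalk G)
two-colouring-or-odd-walk G with any? (λ x → any? λ y → edge? G x y ×-dec (colour x ≟ᵇ colour y))
  module Colouring where
  everywhere : Vertex G → Bool
  everywhere _ = true
  comp : ∀ x → Component G everywhere x
  comp x = component G everywhere x refl
  open Component
  reachable : ∀ x y z {S : Vertex G → Set} → set (comp y) x ≡ true → ReachIn G S x z → set (comp y) z ≡ true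
  reachable x y z p (here _) = p
  reachable x y z p (step {y = v} r e _) = closed (comp y) v z (reachable x y v p r) e refl
  same-⊆ : ∀ {x y} → Edge G x y → ∀ z → set (comp x) z ≡ true → set (comp y) z ≡ true
  same-⊆ {x} {y} e z p = reachable x y z (closed (comp y) y x (root (comp y)) (edge-sym G e) refl) (reach (comp x) z p)
  same : ∀ {x y} → Edge G x y → ∀ z → set (comp x) z ≡ set (comp y) z
  same {x} {y} e z with true-or-false (set (comp x) z) | true-or-false (set (comp y) z)
  ... | inj₁ p | _ = trans p (≡-sym (same-⊆ e z p))
  ... | inj₂ p | inj₁ q = ⊥-elim (true≢false (same-⊆ (edge-sym G e) z q) p)
  ... | inj₂ p | inj₂ q = trans p (≡-sym q)
  base : ∀ x → ∃[ r ] (first (set (comp x)) ≡ just r × set (comp x) r ≡ true)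
  base x = first-found (set (comp x)) (root (comp x))
  base-same : ∀ {x y} → Edge G x y → proj₁ (base x) ≡ proj₁ (base y)
  base-same {x} {y} e = just-injective (trans (≡-sym (proj₁ (proj₂ (base x)))) (trans (first-cong (same e)) (proj₁ (proj₂ (base y)))))
  to-base : ∀ x → ∃[ n ] Walk G n x (proj₁ (base x))
  to-base x = reach⇒walk (reach (comp x) _ (proj₂ (proj₂ (base x))))
  colour : Vertex G → Bool
  colour x = odd (proj₁ (to-base x))
... | no proper = inj₁ (colour , λ x y e p → proper (x , y , e , p))
  where open Colouring G
... | yes (x , y , e , p) = inj₂ (close (odd⇒suc-double (suc (m + n)) (cong not even)))
  where
  open Colouring G
  m n : ℕ
  m = proj₁ (to-base y)
  n = proj₁ (to-base x)
  xor-same : ∀ b → b xor b ≡ false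
  xor-same true = refl
  xor-same false = refl
  even : odd (m + n) ≡ false
  even = trans (odd-+ m n) (trans (cong (_xor odd n) (≡-sym p)) (xor-same (odd n)))
  -- The offending edge and the walks from its ends to their common base vertex close up. Equal
  -- colours make `m + n` even, so the total length is odd.
  closed-walk : Walk G (suc (m + n)) x x
  closed-walk = cons y e (proj₂ (to-base y) ++ reverse (subst (Walk G n x) (base-same e) (proj₂ (to-base x))))
  close : ∃[ j ] (suc (m + n) ≡ suc (double j)) → ∃ (OddClosedWalk G)
  close (j , q) = j , x , subst (λ l → Walk G l x x) q closed-walk

two-colouring⇒labelling : ∀ {G N} .{{_ : NonZero N}} → (Σ (Vertex G → Bool) λ c → ∀ x y → Edge G x y → c x ≢ c y) → Labelling N G
two-colouring⇒labelling (c , proper) = (λ x → if c x then 1 else 0) , λ x y e → differ (c x) (c y) (proper x y e)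
  where
  differ : ∀ a b → a ≢ b → Near _ (if a then 1 else 0) (if b then 1 else 0)
  differ true  true  p = ⊥-elim (p refl)
  differ true  false p = inj₂ Cong-refl
  differ false true  p = inj₁ Cong-refl
  differ false false p = ⊥-elim (p refl)

NoOddBelow : Graph → ℕ → Set
NoOddBelow G k = ∀ j → j < k → ¬ OddClosedWalk G j

shortest-odd-walk : ∀ G j → OddClosedWalk G j → ∃[ i ] (OddClosedWalk G i × NoOddBelow G i)
shortest-odd-walk G j w with search (suc j)
  where
  search : ∀ k → (∃[ i ] (OddClosedWalk G i × NoOddBelow G i)) ⊎ NoOddBelow G k
  search zero = inj₂ λ _ ()
  search (suc k) with search k
  ... | inj₁ found = inj₁ found
  ... | inj₂ none with any? (λ x → walk? G (suc (double k)) x x)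
  ... | yes v = inj₁ (k , v , none)
  ... | no ¬v = inj₂ λ i i<1+k → [ none i , (λ { refl → ¬v }) ]′ (ℕₚ.m≤n⇒m<n∨m≡n (s≤s⁻¹ i<1+k))
... | inj₁ found = found
... | inj₂ none = ⊥-elim (none j ≤-refl w)

-- Going back and forth along the first edge adds two to the length. Hence a graph without closed
-- walks of one odd length has none of any smaller odd length.
lengthen : ∀ {G i j} → i ≤ j → OddClosedWalk G i → OddClosedWalk G j
lengthen {j = zero} z≤n w = w
lengthen {G} {i} {suc j} i≤ w with ℕₚ.m≤n⇒m<n∨m≡n i≤
... | inj₂ refl = w
... | inj₁ i< with lengthen {G} (s≤s⁻¹ i<) w
... | x , cons y e v = x , cons y e (cons x (edge-sym G e) (cons y e v))

-- Circuits

-- A closed walk is unrolled into a periodic sequence, so that rotating it is a mere change of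
-- argument. Vertices may repeat within a period.
record Circuit (G : Graph) (N : ℕ) : Set where
  field
    at      : ℕ → Vertex G
    at-edge : ∀ t → Edge G (at t) (at (suc t))
    period  : ∀ t → at (N + t) ≡ at t
open Circuit

walk⇒circuit : ∀ {G M x} → Walk G (suc M) x x → Circuit G (suc M)
walk⇒circuit {G} {M} {x} (cons y e V) = record
  { at = go (cons y e V)
  ; at-edge = go-edge (cons y e V)
  ; period = λ t → trans (go-period (cons y e V) t) (restart t)
  }
  where
  go : ∀ {n v} → Walk G n v x → ℕ → Vertex G
  go {v = v} w zero = v
  -- At its end the walk continues to `y`, as it did from its start.
  go nil (suc t) = go V t
  go (cons _ _ w) (suc t) = go w t
  go-edge : ∀ {n v} (w : Walk G n v x) t → Edge G (go w t) (go w (suc t))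
  go-edge nil zero = e
  go-edge nil (suc t) = go-edge V t
  go-edge (cons _ f w) zero = f
  go-edge (cons _ f w) (suc t) = go-edge w t
  go-period : ∀ {n v} (w : Walk G n v x) t → go w (n + t) ≡ go nil t
  go-period nil t = refl
  go-period (cons _ _ w) t = go-period w t
  restart : ∀ t → go nil t ≡ go (cons y e V) t
  restart zero = refl
  restart (suc t) = refl

rotate : ∀ {G N} → ℕ → Circuit G N → Circuit G N
rotate {N = N} i C = record
  { at = λ t → at C (t + i)
  ; at-edge = λ t → at-edge C (t + i)
  ; period = λ t → trans (cong (at C) (+-assoc N t i)) (period C (t + i))
  }

segment : ∀ {G N} (C : Circuit G N) s t → Walk G t (at C s) (at C (t + s))
segment C s zero = nil
segment C s (suc t) = snoc (segment C s t) (at-edge C (t + s))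

at-% : ∀ {G M} (C : Circuit G (suc M)) t → at C (t % suc M) ≡ at C t
at-% {M = M} C t = trans (≡-sym (multiples (t / suc M) (t % suc M)))
  (cong (at C) (trans (+-comm _ (t % suc M)) (≡-sym (m≡m%n+[m/n]*n t (suc M)))))
  where
  multiples : ∀ q s → at C (q * suc M + s) ≡ at C s
  multiples zero s = refl
  multiples (suc q) s = trans (cong (at C) (+-assoc (suc M) (q * suc M) s)) (trans (period C _) (multiples q s))

at-Cong : ∀ {G M} (C : Circuit G (suc M)) {s t} → Cong (suc M) s t → at C s ≡ at C t
at-Cong C {s} {t} (residues p) = trans (≡-sym (at-% C s)) (trans (cong (at C) p) (at-% C t))

circuit⇒hom : ∀ {M G} → Circuit G (suc (suc M)) → Hom (Cyc M) G
circuit⇒hom {M} {G} C = (λ x → at C (toℕ x)) , λ x y xy →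
  [ follow x y , (λ p → edge-sym G (follow y x p)) ]′ (Cyc-edge⁻ x y xy)
  where
  follow : ∀ x y → next x ≡ y → Edge G (at C (toℕ x)) (at C (toℕ y))
  follow x y refl = subst (Edge G _)
    (≡-sym (trans (cong (at C) (toℕ-fromℕ< (m%n<n (suc (toℕ x)) (suc (suc M))))) (at-% C (suc (toℕ x)))))
    (at-edge C (toℕ x))

double-mono : ∀ {i j} → i ≤ j → double i ≤ double j
double-mono z≤n = z≤n
double-mono (s≤s p) = s≤s (s≤s (double-mono p))

m≤double : ∀ m → m ≤ double m
m≤double zero = z≤n
m≤double (suc m) = s≤s (≤-trans (m≤double m) (n≤1+n _))

module Shortest {G : Graph} {j : ℕ} (none : NoOddBelow G j) where

  N : ℕ
  N = suc (double j)

  odd-N : odd N ≡ true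
  odd-N = cong not (odd-double j)

  no-short-odd : ∀ {n x} → n < N → odd n ≡ true → ¬ Walk G n x x
  no-short-odd {n} {x} n<N p w with odd⇒suc-double n p
  ... | i , refl = none i (ℕₚ.≰⇒> λ j≤i → ℕₚ.<⇒≱ (s≤s⁻¹ n<N) (double-mono j≤i)) (x , w)

  -- Minimality is used in this form: a repeated vertex or a chord cuts the circuit into two closed
  -- walks shorter than `N`, and the oddness of `N` makes one of their lengths odd.
  no-odd-pair : ∀ {a b x y} → a < N → b < N → odd a xor odd b ≡ true → Walk G a x x → ¬ Walk G b y y
  no-odd-pair {a} {b} a<N b<N p v w with true-or-false (odd a)
  ... | inj₁ q = no-short-odd a<N q v
  ... | inj₂ q = no-short-odd b<N (trans (cong (_xor odd b) (≡-sym q)) p) w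

  odd-parts : ∀ {t b} → t + b ≡ N → odd t xor odd b ≡ true
  odd-parts {t} {b} p = trans (≡-sym (odd-+ t b)) (trans (cong odd p) odd-N)

  module _ (C : Circuit G N) where

    way-back : ∀ s {t b} → t + b ≡ N → Walk G b (at C (t + s)) (at C s)
    way-back s {t} {b} p = subst (Walk G b (at C (t + s))) (trans (cong (at C)
      (trans (≡-sym (+-assoc b t s)) (cong (_+ s) (trans (+-comm b t) p)))) (period C s)) (segment C (t + s) b)

    distinct : ∀ s {t b} → t + b ≡ N → 0 < t → 0 < b → at C s ≢ at C (t + s)
    distinct s {t} {b} p 0<t 0<b q = no-odd-pair
      (subst (t <_) p (ℕₚ.m<m+n t 0<b)) (subst (b <_) p (ℕₚ.m<n+m b 0<t)) (odd-parts {t} p)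
      (subst (Walk G t (at C s)) (≡-sym q) (segment C s t))
      (subst (Walk G b (at C (t + s))) q (way-back s {t} p))

    -- A chord closes both arcs, giving closed walks of lengths `t + 1` and `b + 1`. Their sum
    -- `N + 2` is odd, and both are shorter than `N` when the arcs have at least two edges.
    chordless : ∀ s t b → t + b ≡ N → 0 < t → 0 < b → Edge G (at C s) (at C (t + s)) → (t ≡ 1) ⊎ (b ≡ 1)
    chordless s (suc zero) b p 0<t 0<b e = inj₁ refl
    chordless s (suc (suc t)) (suc zero) p 0<t 0<b e = inj₂ refl
    chordless s t′@(suc (suc t)) b′@(suc (suc b)) p 0<t 0<b e = ⊥-elim (no-odd-pair
      (subst (suc t′ <_) p (≤-trans (s≤s (s≤s (m≤n+m (suc (suc t)) b))) (≤-reflexive (+-comm b′ t′))))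
      (subst (suc b′ <_) p (s≤s (s≤s (m≤n+m b′ t))))
      (trans (not-xor-not (odd t′) (odd b′)) (odd-parts {t′} {b′} p))
      (snoc (segment C s t′) (edge-sym G e))
      (snoc (way-back s {t′} p) e))
      where
      not-xor-not : ∀ a b → not a xor not b ≡ a xor b
      not-xor-not true  true  = refl
      not-xor-not true  false = refl
      not-xor-not false true  = refl
      not-xor-not false false = refl

    private
      gap : ∀ {s t} → s < t → t < N → ∃[ n ] ∃[ b ] ((n + s ≡ t) × (n + b ≡ N) × (0 < n) × (0 < b))
      gap {s} {t} s<t t<N = t ∸ s , N ∸ (t ∸ s) , m∸n+n≡m (ℕₚ.<⇒≤ s<t) , m+[n∸m]≡n (ℕₚ.<⇒≤ d<N) ,
        ℕₚ.m<n⇒0<n∸m s<t , ℕₚ.m<n⇒0<n∸m d<N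
        where
        d<N : t ∸ s < N
        d<N = ≤-<-trans (ℕₚ.m∸n≤m t s) t<N

    at-injective : ∀ {s t} → s < N → t < N → at C s ≡ at C t → s ≡ t
    at-injective {s} {t} s<N t<N p with <-cmp s t
    ... | tri≈ _ q _ = q
    ... | tri< s<t _ _ with gap s<t t<N
    ... | n , b , refl , q , 0<n , 0<b = ⊥-elim (distinct s {n} q 0<n 0<b p)
    at-injective {s} {t} s<N t<N p | tri> _ _ t<s with gap t<s s<N
    ... | n , b , refl , q , 0<n , 0<b = ⊥-elim (distinct t {n} q 0<n 0<b (≡-sym p))

    consecutive : ∀ {s t} → s < t → t < N → Edge G (at C s) (at C t) → (t ≡ suc s) ⊎ ((s ≡ 0) × (suc t ≡ N))
    consecutive {s} s<t t<N e with gap s<t t<N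
    ... | n , b , refl , q , 0<n , 0<b with chordless s n b q 0<n 0<b e
    ... | inj₁ refl = inj₁ refl
    -- Now `b` is 1, so `n` is `N − 1`; as `n + s` is below `N`, the edge starts at position 0.
    ... | inj₂ refl = inj₂ (s≡0 , trans (cong suc (trans (cong (n +_) s≡0) (+-identityʳ n))) (trans (+-comm 1 n) q))
      where
      s≡0 : s ≡ 0
      s≡0 = ℕₚ.n≤0⇒n≡0 (ℕₚ.+-cancelˡ-≤ n s 0 (s≤s⁻¹ (≤-trans t<N (≤-reflexive (trans (≡-sym q) (+-suc n 0))))))

    OnCircuit : Vertex G → Set
    OnCircuit x = ∃[ i ] (at C (toℕ {N} i) ≡ x)

    onCircuit? : ∀ x → Dec (OnCircuit x)
    onCircuit? x = any? λ i → at C (toℕ i) ≟ x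

    at-onCircuit : ∀ t → OnCircuit (at C t)
    at-onCircuit t = t mod N , trans (cong (at C) (toℕ-fromℕ< (m%n<n t N))) (at-% C t)

    circuit-labelling : (∀ x y → Edge G x y → OnCircuit x) → Labelling N G
    circuit-labelling cover = (λ x → label (onCircuit? x)) , near
      where
      label : ∀ {x} → Dec (OnCircuit x) → ℕ
      label (yes (i , _)) = toℕ i
      -- By `cover`, a vertex off the circuit is isolated and may have any label.
      label (no _) = 0
      near-positions : ∀ s t → s < N → t < N → Edge G (at C s) (at C t) → Near N s t
      near-positions s t s<N t<N e with <-cmp s t
      ... | tri≈ _ refl _ = ⊥-elim (no-loop G e)
      ... | tri< s<t _ _ with consecutive s<t t<N e
      ... | inj₁ refl = inj₁ Cong-refl
      ... | inj₂ (refl , p) = inj₂ (Cong-sym (Cong-trans (Cong-reflexive p) (Cong-+N 0)))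
      near-positions s t s<N t<N e | tri> _ _ t<s with consecutive t<s s<N (edge-sym G e)
      ... | inj₁ refl = inj₂ Cong-refl
      ... | inj₂ (refl , p) = inj₁ (Cong-sym (Cong-trans (Cong-reflexive p) (Cong-+N 0)))
      near : ∀ x y → Edge G x y → Near N (label (onCircuit? x)) (label (onCircuit? y))
      near x y e with onCircuit? x | onCircuit? y
      ... | yes (i , refl) | yes (k , refl) = near-positions (toℕ i) (toℕ k) (toℕ<n i) (toℕ<n k) e
      ... | no ¬p | _ = ⊥-elim (¬p (cover x y e))
      ... | yes _ | no ¬p = ⊥-elim (¬p (cover y x (edge-sym G e)))

-- Minors from a shortest odd circuit and a connected set off it

module CircuitMinor {G : Graph} {j : ℕ} (none : NoOddBelow G j) (C : Circuit G (suc (double j)))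
                    {P : Vertex G → Bool} {d : Vertex G} (D : Region G P d)
                    (off : ∀ t → Region.set D (at C t) ≡ false) where

  open Shortest none
  open Region D

  Attached : ℕ → Set
  Attached t = ∃[ x ] (set x ≡ true × Edge G x (at C t))

  -- The connected set becomes the branch set of hub, and the arcs of the circuit
  -- on which κ is constant become the remaining branch sets.
  module Model (H : Graph) (hub : Vertex H) {m : ℕ} (κ : ℕ → Fin m) (κ-mono : ∀ {s t} → s ≤ t → toℕ (κ s) ≤ toℕ (κ t))
               (rim : Fin m → Vertex H) (rim⁻¹ : Vertex H → Fin m) (rim⁻¹-rim : ∀ i → rim⁻¹ (rim i) ≡ i)
               (rim≢hub : ∀ i → rim i ≢ hub) where

    rim-branch : ∀ {x} → Dec (OnCircuit C x) → Maybe (Vertex H)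
    rim-branch (yes (i , _)) = just (rim (κ (toℕ i)))
    rim-branch (no _) = nothing

    branch : Vertex G → Maybe (Vertex H)
    branch x = if set x then just hub else rim-branch (onCircuit? C x)

    branch-hub : ∀ x → set x ≡ true → branch x ≡ just hub
    branch-hub x p rewrite p = refl

    branch-rim : ∀ {t} → t < N → branch (at C t) ≡ just (rim (κ t))
    branch-rim {t} t<N rewrite off t with onCircuit? C (at C t)
    ... | yes (i , p) = cong (λ s → just (rim (κ s))) (at-injective C (toℕ<n i) t<N p)
    ... | no ¬p = ⊥-elim (¬p (at-onCircuit C t))

    branch⁻ : ∀ x {h} → branch x ≡ just h → ((set x ≡ true) × (h ≡ hub)) ⊎ ∃[ t ] (t < N × at C t ≡ x × h ≡ rim (κ t))
    branch⁻ x p with set x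
    branch⁻ x refl | true = inj₁ (refl , refl)
    branch⁻ x p | false with onCircuit? C x
    branch⁻ x refl | false | yes (i , q) = inj₂ (toℕ i , toℕ<n i , q , refl)

    -- Since `κ` is monotone and no larger at the far end than at the start, it is constant on the
    -- whole arc.
    arc : ∀ {s} n → n + s < N → toℕ (κ (n + s)) ≤ toℕ (κ s) → ReachIn G (λ g → branch g ≡ just (rim (κ s))) (at C s) (at C (n + s))
    arc zero b p = here (branch-rim b)
    arc {s} (suc n) b p = step (arc n (<-trans ≤-refl b) (≤-trans (κ-mono (n≤1+n (n + s))) p)) (at-edge C (n + s))
      (trans (branch-rim b) (cong (λ i → just (rim i)) (toℕ-injective (ℕₚ.≤-antisym p (κ-mono (m≤n+m s (suc n)))))))

    arc-between : ∀ {s t} → s ≤ t → t < N → κ s ≡ κ t → ReachIn G (λ g → branch g ≡ just (rim (κ s))) (at C s) (at C t)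
    arc-between {s} {t} s≤t t<N p = subst (λ u → ReachIn G _ (at C s) (at C u)) eq
      (arc (t ∸ s) (subst (_< N) (≡-sym eq) t<N) (≤-reflexive (trans (cong (toℕ ∘ κ) eq) (cong toℕ (≡-sym p)))))
      where
      eq : t ∸ s + s ≡ t
      eq = m∸n+n≡m s≤t

    hub-to : ∀ {x} → set x ≡ true → ReachIn G (λ g → branch g ≡ just hub) d x
    hub-to {x} p = reach-map id branch-hub (λ _ _ → id) (reach x p)

    Connected : Vertex H → Set
    Connected h = ∀ x y → branch x ≡ just h → branch y ≡ just h → ReachIn G (λ g → branch g ≡ just h) x y

    connected : ∀ h → Connected h
    connected h x y p q with branch⁻ x p | branch⁻ y q
    ... | inj₁ (px , refl) | inj₁ (py , _) = reach-trans (reach-sym (hub-to px)) (hub-to py)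
    ... | inj₁ (_ , refl) | inj₂ (t , _ , _ , r) = ⊥-elim (rim≢hub (κ t) (≡-sym r))
    ... | inj₂ (t , _ , _ , r) | inj₁ (_ , refl) = ⊥-elim (rim≢hub (κ t) (≡-sym r))
    ... | inj₂ (s , s<N , refl , refl) | inj₂ (t , t<N , refl , r) with κs≡κt
      where
      κs≡κt : κ s ≡ κ t
      κs≡κt = trans (≡-sym (rim⁻¹-rim (κ s))) (trans (cong rim⁻¹ r) (rim⁻¹-rim (κ t)))
    ... | κ≡ with ℕₚ.≤-total s t
    ... | inj₁ s≤t = arc-between s≤t t<N κ≡
    ... | inj₂ t≤s = reach-sym (subst (λ i → ReachIn G (λ g → branch g ≡ just (rim i)) (at C t) (at C s)) (≡-sym κ≡)
                       (arc-between t≤s s<N (≡-sym κ≡)))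

    Link : Vertex H → Vertex H → Set
    Link h h′ = ∃[ x ] ∃[ y ] (branch x ≡ just h × branch y ≡ just h′ × Edge G x y)

    link-sym : ∀ {h h′} → Link h h′ → Link h′ h
    link-sym (x , y , p , q , e) = y , x , q , p , edge-sym G e

    at-branch : ∀ {t i} → t < N → κ t ≡ i → branch (at C t) ≡ just (rim i)
    at-branch t<N refl = branch-rim t<N

    link-step : ∀ t {i i′} → suc t < N → κ t ≡ i → κ (suc t) ≡ i′ → Link (rim i) (rim i′)
    link-step t b p q = at C t , at C (suc t) , at-branch (<-trans ≤-refl b) p , at-branch b q , at-edge C t

    link-wrap : ∀ t {i i′} → suc t ≡ N → κ t ≡ i → κ 0 ≡ i′ → Link (rim i) (rim i′)
    link-wrap t b p q = at C t , at C 0 , at-branch (≤-reflexive b) p , at-branch (s≤s z≤n) q ,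
      subst (Edge G (at C t)) (trans (cong (at C) (trans b (≡-sym (+-identityʳ N)))) (period C 0)) (at-edge C t)

    link-hub : ∀ {t i} → Attached t → t < N → κ t ≡ i → Link hub (rim i)
    link-hub {t} (x , p , e) t<N q = x , at C t , branch-hub x p , at-branch t<N q , e

    model : (∀ h → (h ≡ hub) ⊎ ∃[ t ] (t < N × rim (κ t) ≡ h)) → (∀ h h′ → Edge H h h′ → Link h h′) → MinorModel H G
    model onto links = record
      { branch = branch
      ; nonempty = λ h → [ (λ { refl → d , branch-hub d root }) , (λ { (t , t<N , refl) → at C t , branch-rim t<N }) ]′ (onto h)
      ; connected = connected
      ; edges = links
      }

  -- The circuit vertices at 0 and `t` form the side of size two of K23. The other side consists of
  -- the hub and the two open arcs between them, which are nonempty because `t` and `b` exceed 1.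
  module _ {t b : ℕ} (1<t : 1 < t) (1<b : 1 < b) (t+b≡N : t + b ≡ N) (att₀ : Attached 0) (att : Attached t) where

    private
      κ : ℕ → Fin 4
      κ zero = 0F
      κ (suc u) with <-cmp (suc u) t
      ... | tri< _ _ _ = 1F
      ... | tri≈ _ _ _ = 2F
      ... | tri> _ _ _ = 3F

      κ-< : ∀ {u} → 0 < u → u < t → κ u ≡ 1F
      κ-< {suc u} _ p with <-cmp (suc u) t
      ... | tri< _ _ _ = refl
      ... | tri≈ ¬p _ _ = ⊥-elim (¬p p)
      ... | tri> ¬p _ _ = ⊥-elim (¬p p)

      κ-≡ : ∀ {u} → 0 < u → u ≡ t → κ u ≡ 2F
      κ-≡ {suc u} _ p with <-cmp (suc u) t
      ... | tri< _ ¬p _ = ⊥-elim (¬p p)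
      ... | tri≈ _ _ _ = refl
      ... | tri> _ ¬p _ = ⊥-elim (¬p p)

      κ-> : ∀ {u} → t < u → κ u ≡ 3F
      κ-> {suc u} p with <-cmp (suc u) t
      ... | tri< _ _ ¬p = ⊥-elim (¬p p)
      ... | tri≈ _ _ ¬p = ⊥-elim (¬p p)
      ... | tri> _ _ _ = refl

      κ-mono : ∀ {u v} → u ≤ v → toℕ (κ u) ≤ toℕ (κ v)
      κ-mono {zero} _ = z≤n
      κ-mono {suc u} {suc v} p with <-cmp (suc u) t | <-cmp (suc v) t
      ... | tri< _ _ _ | tri< _ _ _ = s≤s z≤n
      ... | tri< _ _ _ | tri≈ _ _ _ = s≤s z≤n
      ... | tri< _ _ _ | tri> _ _ _ = s≤s z≤n
      ... | tri≈ _ _ _ | tri≈ _ _ _ = ≤-refl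
      ... | tri≈ _ _ _ | tri> _ _ _ = s≤s (s≤s z≤n)
      ... | tri> _ _ _ | tri> _ _ _ = ≤-refl
      ... | tri≈ ¬q _ _ | tri< r _ _ = ⊥-elim (¬q (≤-<-trans p r))
      ... | tri> _ _ q | tri< r _ _ = ⊥-elim (ℕₚ.<-asym q (≤-<-trans p r))
      ... | tri> _ _ q | tri≈ _ r _ = ⊥-elim (ℕₚ.<⇒≱ q (subst (suc u ≤_) r p))

      rim : Fin 4 → Fin 5
      rim 0F = 0F
      rim 1F = 3F
      rim 2F = 1F
      rim 3F = 4F

      -- The value at 2F, the hub, is arbitrary.
      rim⁻¹ : Fin 5 → Fin 4
      rim⁻¹ 0F = 0F
      rim⁻¹ 1F = 2F
      rim⁻¹ 2F = 0F
      rim⁻¹ 3F = 1F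
      rim⁻¹ 4F = 3F

      rim⁻¹-rim : ∀ i → rim⁻¹ (rim i) ≡ i
      rim⁻¹-rim 0F = refl
      rim⁻¹-rim 1F = refl
      rim⁻¹-rim 2F = refl
      rim⁻¹-rim 3F = refl

      rim≢hub : ∀ i → rim i ≢ 2F
      rim≢hub 0F ()
      rim≢hub 1F ()
      rim≢hub 2F ()
      rim≢hub 3F ()

      open Model K23 2F κ κ-mono rim rim⁻¹ rim⁻¹-rim rim≢hub

      0<t : 0 < t
      0<t = <-trans (s≤s z≤n) 1<t

      t+1<N : suc t < N
      t+1<N = subst (suc t <_) t+b≡N (subst (_≤ t + b) (+-comm t 2) (+-mono-≤ (≤-refl {t}) 1<b))

      t<N : t < N
      t<N = <-trans ≤-refl t+1<N

      1<N : 1 < N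
      1<N = <-trans 1<t t<N

      κt : κ t ≡ 2F
      κt = κ-≡ 0<t refl

      before-t : ∃[ u ] (suc u ≡ t × κ u ≡ 1F)
      before-t = t ∸ 1 , suc-pred-t , κ-< (ℕₚ.m<n⇒0<n∸m 1<t) (≤-reflexive suc-pred-t)
        where
        suc-pred-t : suc (t ∸ 1) ≡ t
        suc-pred-t = m+[n∸m]≡n 0<t

      link-0-hub : Link 2F 0F
      link-0-hub = link-hub att₀ (s≤s z≤n) refl

      link-t-hub : Link 2F 1F
      link-t-hub = link-hub att t<N κt

      link-0-3 : Link 0F 3F
      link-0-3 = link-step 0 1<N refl (κ-< (s≤s z≤n) 1<t)

      link-3-1 : Link 3F 1F
      link-3-1 with before-t
      ... | u , p , κu = link-step u (subst (_< N) (≡-sym p) t<N) κu (trans (cong κ p) κt)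

      link-1-4 : Link 1F 4F
      link-1-4 = link-step t t+1<N κt (κ-> ≤-refl)

      link-4-0 : Link 4F 0F
      link-4-0 = link-wrap (double j) refl (κ-> (s≤s⁻¹ t+1<N)) refl

      onto : ∀ h → (h ≡ 2F) ⊎ ∃[ u ] (u < N × rim (κ u) ≡ h)
      onto 0F = inj₂ (0 , s≤s z≤n , refl)
      onto 1F = inj₂ (t , t<N , cong rim κt)
      onto 2F = inj₁ refl
      onto 3F = inj₂ (1 , 1<N , cong rim (κ-< (s≤s z≤n) 1<t))
      onto 4F = inj₂ (suc t , t+1<N , cong rim (κ-> ≤-refl))

      links : ∀ h h′ → Edge K23 h h′ → Link h h′
      links 0F 2F _ = link-sym link-0-hub
      links 0F 3F _ = link-0-3
      links 0F 4F _ = link-sym link-4-0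
      links 1F 2F _ = link-sym link-t-hub
      links 1F 3F _ = link-sym link-3-1
      links 1F 4F _ = link-1-4
      links 2F 0F _ = link-0-hub
      links 2F 1F _ = link-t-hub
      links 3F 0F _ = link-sym link-0-3
      links 3F 1F _ = link-3-1
      links 4F 0F _ = link-4-0
      links 4F 1F _ = link-sym link-1-4
      links 0F 0F ()
      links 0F 1F ()
      links 1F 0F ()
      links 1F 1F ()
      links 2F 2F ()
      links 2F 3F ()
      links 2F 4F ()
      links 3F 2F ()
      links 3F 3F ()
      links 3F 4F ()
      links 4F 2F ()
      links 4F 3F ()
      links 4F 4F ()

    K23-minor : IsMinorOf K23 G
    K23-minor = model onto links

  -- A triangle is too short for the K23 construction, but its three vertices together with the hub
  -- form K4.
  module _ (N≡3 : N ≡ 3) (att₀ : Attached 0) (att₁ : Attached 1) (att₂ : Attached 2) where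

    private
      κ : ℕ → Fin 3
      κ 0 = 0F
      κ 1 = 1F
      κ (suc (suc _)) = 2F

      κ-mono : ∀ {u v} → u ≤ v → toℕ (κ u) ≤ toℕ (κ v)
      κ-mono {0} _ = z≤n
      κ-mono {1} {1} _ = ≤-refl
      κ-mono {1} {suc (suc _)} _ = s≤s z≤n
      κ-mono {suc (suc _)} {suc (suc _)} _ = ≤-refl
      κ-mono {suc (suc _)} {1} (s≤s ())

      rim⁻¹ : Fin 4 → Fin 3
      rim⁻¹ 0F = 0F
      rim⁻¹ (suc i) = i

      rim : Fin 3 → Fin 4
      rim = suc

      rim≢hub : ∀ i → rim i ≢ 0F
      rim≢hub i ()

      rim⁻¹-rim : ∀ i → rim⁻¹ (rim i) ≡ i
      rim⁻¹-rim i = refl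

      open Model K4 0F κ κ-mono rim rim⁻¹ rim⁻¹-rim rim≢hub

      <N : ∀ {u} → u < 3 → u < N
      <N {u} = subst (u <_) (≡-sym N≡3)

      1<N : 1 < N
      1<N = <N (s≤s (s≤s z≤n))

      2<N : 2 < N
      2<N = <N (s≤s (s≤s (s≤s z≤n)))

      onto : ∀ h → (h ≡ 0F) ⊎ ∃[ u ] (u < N × rim (κ u) ≡ h)
      onto 0F = inj₁ refl
      onto 1F = inj₂ (0 , s≤s z≤n , refl)
      onto 2F = inj₂ (1 , 1<N , refl)
      onto 3F = inj₂ (2 , 2<N , refl)

      links-< : ∀ h h′ → toℕ h < toℕ h′ → Link h h′
      links-< 0F 1F _ = link-hub att₀ (s≤s z≤n) refl
      links-< 0F 2F _ = link-hub att₁ 1<N refl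
      links-< 0F 3F _ = link-hub att₂ 2<N refl
      links-< 1F 2F _ = link-step 0 1<N refl refl
      links-< 1F 3F _ = link-sym (link-wrap 2 (≡-sym N≡3) refl refl)
      links-< 2F 3F _ = link-step 1 2<N refl refl
      links-< 1F 1F (s≤s ())
      links-< 2F 1F (s≤s ())
      links-< 2F 2F (s≤s (s≤s ()))
      links-< 3F 1F (s≤s ())
      links-< 3F 2F (s≤s (s≤s ()))
      links-< 3F 3F (s≤s (s≤s (s≤s ())))

      links : ∀ h h′ → Edge K4 h h′ → Link h h′
      links h h′ e with <-cmp (toℕ h) (toℕ h′)
      ... | tri< p _ _ = links-< h h′ p
      ... | tri> _ _ p = link-sym (links-< h′ h p)
      ... | tri≈ _ p _ with refl ← toℕ-injective p = ⊥-elim (no-loop K4 {h} e)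

    K4-minor : IsMinorOf K4 G
    K4-minor = model onto links

-- In an outerplanar graph, a connected set off a shortest odd circuit is attached to it only at the ends of one edge.
module Attachment {G : Graph} {j : ℕ} (none : NoOddBelow G j) (outer : Outerplanar G)
                  {P : Vertex G → Bool} {d : Vertex G} (D : Region G P d) where

  open Shortest none
  open Region D

  module _ (C : Circuit G N) (off : ∀ t → set (at C t) ≡ false) where

    open CircuitMinor none

    private
      Att : ℕ → Set
      Att = Attached C D off

    attached? : ∀ t → Dec (Att t)
    attached? t = any? λ x → (set x ≟ᵇ true) ×-dec edge? G x (at C t)

    no-K23 : ∀ s {t b} → 1 < t → 1 < b → t + b ≡ N → Att s → ¬ Att (t + s)
    no-K23 s 1<t 1<b p a₀ a = proj₂ outer (K23-minor (rotate s C) D (λ u → off (u + s)) 1<t 1<b p a₀ a)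

    no-K4 : N ≡ 3 → ∀ s → Att s → Att (1 + s) → ¬ Att (2 + s)
    no-K4 p s a₀ a₁ a₂ = proj₁ outer (K4-minor (rotate s C) D (λ u → off (u + s)) p a₀ a₁ a₂)

    resp-att : ∀ {s t} → at C s ≡ at C t → Att s → Att t
    resp-att p (x , q , e) = x , q , subst (Edge G x) p e

    -- Any other position below `N` is at least two steps from 0 both ways round, which yields K23.
    -- The last position is `double j`, that is `N − 1`.
    attached-position : ∀ {t} → Att 0 → Att t → t < N → (t ≡ 0) ⊎ (t ≡ 1) ⊎ (t ≡ double j)
    attached-position {zero} a₀ a t<N = inj₁ refl
    attached-position {suc zero} a₀ a t<N = inj₂ (inj₁ refl)
    attached-position {t@(suc (suc _))} a₀ a t<N with ℕₚ.m≤n⇒m<n∨m≡n t<N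
    ... | inj₂ p = inj₂ (inj₂ (ℕₚ.suc-injective p))
    ... | inj₁ t+1<N = ⊥-elim (no-K23 0 (s≤s (s≤s z≤n)) (ℕₚ.m+n≤o⇒m≤o∸n 2 t+1<N) (m+[n∸m]≡n (ℕₚ.<⇒≤ t<N)) a₀
                         (subst Att (≡-sym (+-identityʳ t)) a))

    -- The two neighbours of `at C 0` are joined by arcs of lengths 2 and `N − 2`. If `N` is at
    -- least 5, both arcs have inner vertices and K23 arises; if `N` is 3, all vertices of the
    -- triangle are attached and K4 arises.
    not-both-sides : 0 < j → Att 0 → Att 1 → ¬ Att (double j)
    not-both-sides 0<j a₀ a₁ a = cases j refl 0<j
      where
      cases : ∀ i → j ≡ i → 0 < i → ⊥
      cases (suc zero) p _ = no-K4 (cong (suc ∘ double) p) 0 a₀ a₁ (subst Att (cong double p) a)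
      cases (suc (suc i)) p _ = no-K23 1 {suc (suc (suc (double i)))} {2} (s≤s (s≤s z≤n)) ≤-refl
        (trans (+-comm _ 2) (cong (suc ∘ double) (≡-sym p))) a₁ (subst Att (trans (cong double p) (+-comm 1 _)) a)

    EdgeSpan : Set
    EdgeSpan = ∃[ a ] (∀ t → Att t → (at C t ≡ at C a) ⊎ (at C t ≡ at C (suc a)))

    -- Besides at 0, the set can only be attached at one of the two neighbours of at 0.
    span-from-0 : 0 < j → Att 0 → EdgeSpan
    span-from-0 0<j a₀ with attached? 1
    ... | yes a₁ = 0 , λ t a → from (t % N) (at-% C t) (m%n<n t N) (resp-att (≡-sym (at-% C t)) a)
      where
      from : ∀ s {x} → at C s ≡ x → s < N → Att s → (x ≡ at C 0) ⊎ (x ≡ at C 1)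
      from s refl s<N a with attached-position a₀ a s<N
      ... | inj₁ refl = inj₁ refl
      ... | inj₂ (inj₁ refl) = inj₂ refl
      ... | inj₂ (inj₂ refl) = ⊥-elim (not-both-sides 0<j a₀ a₁ a)
    -- The edge sought is the one entering `at C 0`: it runs from position `double j` to position
    -- `N`, where the circuit is back at `at C 0`.
    ... | no ¬a₁ = double j , λ t a → from (t % N) (at-% C t) (m%n<n t N) (resp-att (≡-sym (at-% C t)) a)
      where
      from : ∀ s {x} → at C s ≡ x → s < N → Att s → (x ≡ at C (double j)) ⊎ (x ≡ at C N)
      from s refl s<N a with attached-position a₀ a s<N
      ... | inj₁ refl = inj₂ (≡-sym (trans (cong (at C) (≡-sym (+-identityʳ N))) (period C 0)))
      ... | inj₂ (inj₁ refl) = ⊥-elim (¬a₁ a)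
      ... | inj₂ (inj₂ refl) = inj₁ refl

  edge-span : 0 < j → (C : Circuit G N) (off : ∀ t → set (at C t) ≡ false) → EdgeSpan C off
  edge-span 0<j C off with any? (λ i → attached? C off (toℕ {N} i))
  ... | no ¬a = 0 , λ t a → ⊥-elim (¬a (t mod N , resp-att C off (≡-sym (proj₂ (at-onCircuit C t))) a))
  ... | yes (i , aᵢ) with span-from-0 (rotate (toℕ i) C) (λ u → off (u + toℕ i)) 0<j aᵢ
  ... | a , spans = a + toℕ i , λ t att → subst (λ x → (x ≡ at C (a + toℕ i)) ⊎ (x ≡ at C (suc a + toℕ i))) (turn t)
                      (spans (t + double j * toℕ i) (resp-att C off (≡-sym (turn t)) att))
    where
    -- `double j` is -1 modulo `N`, so adding `double j * toℕ i` undoes the rotation by `toℕ i`.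
    turn : ∀ t → at C (t + double j * toℕ i + toℕ i) ≡ at C t
    turn t = at-Cong C (Cong-trans (Cong-reflexive (trans (+-assoc t _ _) (cong (t +_)
      (trans (+-comm _ (toℕ i)) (ℕₚ.*-comm N (toℕ i)))))) (Cong-+*N t (toℕ i)))

-- Labelling outerplanar graphs

-- Vertices outside `S` remain as isolated ones, so that walks, minor models and labellings carry
-- over without renumbering.
induced : (G : Graph) → (Vertex G → Bool) → Graph
induced G S = record
  { size = size G
  ; adj = λ x y → adj G x y ∧ (S x ∧ S y)
  ; sym = λ x y → cong₂ _∧_ (sym G x y) (∧-comm (S x) (S y))
  ; irrefl = λ x → cong (_∧ (S x ∧ S x)) (irrefl G x)
  }

induced-edge⁻ : ∀ {G} S x y → Edge (induced G S) x y → Edge G x y × (S x ≡ true)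
induced-edge⁻ {G} S x y e = proj₁ (∧-true {adj G x y} e) , proj₁ (∧-true (proj₂ (∧-true {adj G x y} e)))

minor-of-induced : ∀ {H G} S → IsMinorOf H (induced G S) → IsMinorOf H G
minor-of-induced {H} {G} S m = record
  { branch = branch
  ; nonempty = nonempty
  ; connected = λ h x y p q → reach-map id (λ _ → id) ⊆-edge (connected h x y p q)
  ; edges = λ h h′ e → let (x , y , p , q , xy) = edges h h′ e in x , y , p , q , ⊆-edge x y xy
  }
  where
  open MinorModel m
  ⊆-edge : ∀ x y → Edge (induced G S) x y → Edge G x y
  ⊆-edge x y e = proj₁ (induced-edge⁻ {G} S x y e)

induced-outerplanar : ∀ {G} S → Outerplanar G → Outerplanar (induced G S)
induced-outerplanar {G} S (no-K4 , no-K23) =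
  (λ m → no-K4 (minor-of-induced {G = G} S m)) , (λ m → no-K23 (minor-of-induced {G = G} S m))

induced-NoOddBelow : ∀ {G} S {k} → NoOddBelow G k → NoOddBelow (induced G S) k
induced-NoOddBelow {G} S none i i<k (x , w) =
  none i i<k (x , walk-map id (λ x y e → proj₁ (induced-edge⁻ {G} S x y e)) w)

-- The set D is joined to its complement only through an edge uv outside it, so labellings of the two sides,
-- normalised to agree on u and v, combine.
glue : ∀ {M G} (S D : Vertex G → Bool) → (∀ x y → Edge G x y → S x ≡ true) →
       ∀ {u v} → Edge G u v → D u ≡ false → D v ≡ false →
       (∀ x y → Edge G x y → D x ≡ true → D y ≡ false → (y ≡ u) ⊎ (y ≡ v)) →
       Labelling (suc M) (induced G (λ z → S z ∧ not (D z))) →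
       Labelling (suc M) (induced G (λ z → D z ∨ (does (z ≟ u) ∨ does (z ≟ v)))) →
       Labelling (suc M) G
glue {M} {G} S D supp {u} {v} uv Du Dv border L₁ L₂ = f , near
  where
  S₁ S₂ : Vertex G → Bool
  S₁ z = S z ∧ not (D z)
  S₂ z = D z ∨ (does (z ≟ u) ∨ does (z ≟ v))
  in-S₁ : ∀ x y → Edge G x y → D x ≡ false → S₁ x ≡ true
  in-S₁ x y e p = ∧-intro (supp x y e) (cong not p)
  in-S₂ : ∀ x → D x ≡ true → S₂ x ≡ true
  in-S₂ x p rewrite p = refl
  in-S₂′ : ∀ {x} → (x ≡ u) ⊎ (x ≡ v) → S₂ x ≡ true
  in-S₂′ {x} (inj₁ refl) rewrite dec-true (u ≟ u) refl = ∨-zeroʳ (D u)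
  in-S₂′ {x} (inj₂ refl) rewrite dec-true (v ≟ v) refl | ∨-zeroʳ (does (v ≟ u)) = ∨-zeroʳ (D v)
  N₁ = normalise {M} {induced G S₁} {u} {v} (∧-intro uv (∧-intro (in-S₁ u v uv Du) (in-S₁ v u (edge-sym G uv) Dv))) L₁
  N₂ = normalise {M} {induced G S₂} {u} {v} (∧-intro uv (∧-intro (in-S₂′ (inj₁ refl)) (in-S₂′ (inj₂ refl)))) L₂
  f₁ f₂ f : Vertex G → ℕ
  f₁ = proj₁ (proj₁ N₁)
  f₂ = proj₁ (proj₁ N₂)
  f x = if D x then f₂ x else f₁ x
  agree : ∀ {y} → (y ≡ u) ⊎ (y ≡ v) → Cong (suc M) (f₂ y) (f₁ y)
  agree (inj₁ refl) = Cong-trans (proj₁ (proj₂ N₂)) (Cong-sym (proj₁ (proj₂ N₁)))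
  agree (inj₂ refl) = Cong-trans (proj₂ (proj₂ N₂)) (Cong-sym (proj₂ (proj₂ N₁)))
  across : ∀ x y → Edge G x y → D x ≡ true → D y ≡ false → Near (suc M) (f₂ x) (f₁ y)
  -- An edge leaving `D` ends at `u` or `v`, where the two labellings agree, so the label of its far
  -- end can be exchanged.
  across x y e Dx Dy = Near-resp Cong-refl (agree y∈uv)
    (proj₂ (proj₁ N₂) x y (∧-intro e (∧-intro (in-S₂ x Dx) (in-S₂′ y∈uv))))
    where
    y∈uv : (y ≡ u) ⊎ (y ≡ v)
    y∈uv = border x y e Dx Dy
  near : ∀ x y → Edge G x y → Near (suc M) (f x) (f y)
  near x y e with D x in Dx | D y in Dy
  ... | true  | true  = proj₂ (proj₁ N₂) x y (∧-intro e (∧-intro (in-S₂ x Dx) (in-S₂ y Dy)))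
  ... | true  | false = across x y e Dx Dy
  ... | false | true  = ⊎-swap (across y x (edge-sym G e) Dy Dx)
  ... | false | false = proj₂ (proj₁ N₁) x y (∧-intro e (∧-intro (in-S₁ x y e Dx) (in-S₁ y x (edge-sym G e) Dy)))

-- As induced subgraphs keep all vertices, the size of the graph cannot decrease. The measure is the
-- size of a set `S` containing all non-isolated vertices.
label-around-circuit : ∀ {G j} → NoOddBelow G j → Outerplanar G → 0 < j → Circuit G (suc (double j)) →
                       (S : Vertex G → Bool) → (∀ x y → Edge G x y → S x ≡ true) →
                       (∀ T → count T < count S → Labelling (suc (double j)) (induced G T)) →
                       Labelling (suc (double j)) G
label-around-circuit {G} {j} none outer 0<j C S supp smaller
  with any? (λ d → (S d ≟ᵇ true) ×-dec ¬? (Shortest.onCircuit? none C d))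
... | no covered = circuit-labelling C cover
  where
  open Shortest none
  cover : ∀ x y → Edge G x y → OnCircuit C x
  cover x y e with onCircuit? C x
  ... | yes p = p
  ... | no ¬p = ⊥-elim (covered (x , supp x y e , ¬p))
... | yes (d , Sd , ¬on) = glue {G = G} S D supp {u} {v} (at-edge C a) (off a) (off (suc a)) border
                             (smaller _ fewer₁) (smaller _ fewer₂)
  where
  open Shortest none
  P : Vertex G → Bool
  P z = S z ∧ not (does (onCircuit? C z))
  Pd : P d ≡ true
  Pd = ∧-intro Sd (cong not (dec-false (onCircuit? C d) ¬on))
  comp : Component G P d
  comp = component G P d Pd
  open Component comp
  D : Vertex G → Bool
  D = set
  off : ∀ t → D (at C t) ≡ false
  off t = ¬-not λ p → true≢false (proj₂ (∧-true {S (at C t)} (inside (at C t) p)))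
    (cong not (dec-true (onCircuit? C (at C t)) (at-onCircuit C t)))
  open Attachment none outer region using (edge-span)
  span = edge-span 0<j C off
  a : ℕ
  a = proj₁ span
  u v w : Vertex G
  u = at C a
  v = at C (suc a)
  -- This third vertex of the circuit lies outside `D` and differs from `u` and `v`, so the side
  -- made of `D`, `u` and `v` is smaller than `S`; the other side loses `d`.
  w = at C (suc (suc a))
  border : ∀ x y → Edge G x y → D x ≡ true → D y ≡ false → (y ≡ u) ⊎ (y ≡ v)
  border x y e Dx Dy with onCircuit? C y
  ... | yes (i , refl) = proj₂ span (toℕ i) (x , Dx , e)
  ... | no ¬p = ⊥-elim (true≢false (closed x y Dx e (∧-intro (supp y x (edge-sym G e)) (cong not (dec-false (onCircuit? C y) ¬p)))) Dy)
  fewer₁ : count (λ z → S z ∧ not (D z)) < count S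
  fewer₁ = count-< (λ z p → proj₁ (∧-true p)) d (trans (cong (λ b → S d ∧ not b) root) (∧-zeroʳ (S d))) Sd
  S-at : ∀ t → S (at C t) ≡ true
  S-at t = supp (at C t) (at C (suc t)) (at-edge C t)
  2<N : 2 < N
  2<N = s≤s (double-mono 0<j)
  w≢u : w ≢ u
  w≢u p = distinct C a {2} {N ∸ 2} (m+[n∸m]≡n (ℕₚ.<⇒≤ 2<N)) (s≤s z≤n) (ℕₚ.m<n⇒0<n∸m 2<N) (≡-sym p)
  w≢v : w ≢ v
  w≢v p = no-loop G (subst (λ z → Edge G z w) (≡-sym p) (at-edge C (suc a)))
  fewer₂ : count (λ z → D z ∨ (does (z ≟ u) ∨ does (z ≟ v))) < count S
  fewer₂ = count-< ⊆S w (cong₂ _∨_ (off (suc (suc a))) (cong₂ _∨_ (dec-false (w ≟ u) w≢u) (dec-false (w ≟ v) w≢v))) (S-at _)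
    where
    ⊆S : ∀ z → D z ∨ (does (z ≟ u) ∨ does (z ≟ v)) ≡ true → S z ≡ true
    ⊆S z p with ∨-true p
    ... | inj₁ Dz = proj₁ (∧-true (inside z Dz))
    ... | inj₂ q with ∨-true q
    ... | inj₁ r = subst (λ y → S y ≡ true) (≡-sym (does-true {d = z ≟ u} r)) (S-at a)
    ... | inj₂ r = subst (λ y → S y ≡ true) (≡-sym (does-true {d = z ≟ v} r)) (S-at (suc a))

fold-to : ∀ {G k j} → k ≤ j → Labelling (suc (double j)) G → Labelling (suc (double k)) G
fold-to {j = zero} z≤n L = L
fold-to {G} {k} {suc j} k≤ L with ℕₚ.m≤n⇒m<n∨m≡n k≤
... | inj₁ k< = fold-to {G} (s≤s⁻¹ k<) (fold {double j} {G} L)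
... | inj₂ refl = L

-- The recursion runs at the shortest odd length `2j + 1` of `G`, not at `2k + 1`: a shortest
-- circuit is what the graph is cut along, and both sides must be labelled modulo its length.
-- Folding afterwards goes down to `2k + 1`.
outerplanar-labelling : ∀ {G} (S : Vertex G → Bool) → Acc _<_ (count S) → (∀ x y → Edge G x y → S x ≡ true) →
                        Outerplanar G → ∀ {k} → NoOddBelow G k → Labelling (suc (double k)) G
outerplanar-labelling {G} S (acc rec) supp outer {k} none with two-colouring-or-odd-walk G
... | inj₁ colouring = two-colouring⇒labelling {G} colouring
... | inj₂ (i , walk) with shortest-odd-walk G i walk
... | j , (x , w) , none-shorter = fold-to {G} k≤j
  (label-around-circuit none-shorter outer 0<j (walk⇒circuit w) S supp λ T T<S →
    outerplanar-labelling {induced G T} T (rec T<S) (λ x y e → proj₂ (induced-edge⁻ {G} T x y e))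
      (induced-outerplanar {G} T outer) {j} (induced-NoOddBelow {G} T none-shorter))
  where
  k≤j : k ≤ j
  k≤j = ℕₚ.≮⇒≥ λ j<k → none j j<k (x , w)
  0<j : 0 < j
  0<j = ℕₚ.n≢0⇒n>0 λ { refl → no-loops w }
    where
    no-loops : ¬ Walk G 1 x x
    no-loops (cons _ e nil) = no-loop G e

outerplanar⇒hom : ∀ {G} → Outerplanar G → ∀ k → ¬ OddClosedWalk G k → Hom G (Cyc (suc (double k)))
outerplanar⇒hom {G} outer k none = labelling⇒hom {G = G}
  -- The target has length `2k + 3`, hence the index `suc k`; `lengthen` extends the absence of
  -- closed walks of length `2k + 1` to all smaller odd lengths.
  (outerplanar-labelling {G} (λ _ → true) (<-wellFounded _) (λ _ _ _ → refl) outer {suc k}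
    λ i i≤k w → none (lengthen {G} (s≤s⁻¹ i≤k) w))

-- Existential-positive sentences

walkFormula : ∀ {k} → ℕ → Fin k → Fin k → Formula k
walkFormula zero    i j = Eq i j
walkFormula (suc n) i j = ex (_and_ (E (suc i) zero) (walkFormula n zero (suc j)))

walkFormula-ExPos : ∀ {k} n (i j : Fin k) → ExPos (walkFormula n i j)
walkFormula-ExPos zero    i j = Eq i j
walkFormula-ExPos (suc n) i j = ex (and (E (suc i) zero) (walkFormula-ExPos n zero (suc j)))

walkFormula⇒walk : ∀ {k} G n (i j : Fin k) ρ → Sat G (walkFormula n i j) ρ → Walk G n (ρ i) (ρ j)
walkFormula⇒walk G zero    i j ρ p = subst (Walk G 0 (ρ i)) p nil
walkFormula⇒walk G (suc n) i j ρ (v , e , p) = cons v e (walkFormula⇒walk G n zero (suc j) (extend v ρ) p)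

walk⇒walkFormula : ∀ {k} G n (i j : Fin k) ρ {x y} → ρ i ≡ x → ρ j ≡ y → Walk G n x y → Sat G (walkFormula n i j) ρ
walk⇒walkFormula G zero    i j ρ p q nil = trans p (≡-sym q)
walk⇒walkFormula G (suc n) i j ρ refl q (cons v e w) = v , e , walk⇒walkFormula G n zero (suc j) (extend v ρ) refl q w

-- The bottom of the chain, and the choice of the existential-positive sentence

point : Graph
point = record { size = 1 ; adj = λ _ _ → false ; sym = λ _ _ → refl ; irrefl = λ _ → refl }

empty : Graph
empty = record { size = 0 ; adj = λ () ; sym = λ () ; irrefl = λ () }

point-no-minor : ∀ {H} (h h′ : Vertex H) → h ≢ h′ → ¬ IsMinorOf H point
point-no-minor h h′ h≢h′ m with MinorModel.nonempty m h | MinorModel.nonempty m h′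
... | zero , p | zero , q = h≢h′ (just-injective (trans (≡-sym p) q))

empty-no-minor : ∀ {H} → Vertex H → ¬ IsMinorOf H empty
empty-no-minor h m with () ← proj₁ (MinorModel.nonempty m h)

point-outerplanar : Outerplanar point
point-outerplanar = point-no-minor {K4} zero (suc zero) (λ ()) , point-no-minor {K23} zero (suc zero) (λ ())

empty-outerplanar : Outerplanar empty
empty-outerplanar = empty-no-minor {K4} zero , empty-no-minor {K23} zero

least-false : ∀ {P : ℕ → Set} → (∀ k → Dec (P k)) → ∀ n → ¬ P n → ∃[ k ] (¬ P k × (∀ i → i < k → P i))
least-false P? zero ¬p = 0 , ¬p , λ _ ()
least-false {P} P? (suc n) ¬p with P? 0
... | no ¬p₀ = 0 , ¬p₀ , λ _ ()
... | yes p₀ with least-false (P? ∘ suc) n ¬p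
... | k , ¬pₖ , below = suc k , ¬pₖ , λ { zero _ → p₀ ; (suc i) (s≤s i<k) → below i i<k }

theorem4p4 : HPP Outerplanar
theorem4p4 φ preserved with Sat? empty φ (emptyEnv empty)
... | yes on-empty = tt , tt , λ G outer →
  (λ _ → tt) , (λ _ → preserved empty G empty-outerplanar outer ((λ ()) , λ ()) on-empty)
... | no ¬empty with Sat? point φ (emptyEnv point)
... | yes on-point = ex tt , ex tt , λ G outer → to G outer , from G outer
  where
  to : ∀ G → Outerplanar G → G ⊨ φ → G ⊨ ex tt
  to G outer p with any? {P = λ (_ : Vertex G) → ⊤} (λ _ → yes tt)
  ... | yes v = v
  ... | no ¬v = ⊥-elim (¬empty (preserved G empty outer empty-outerplanar
                  ((λ v → ⊥-elim (¬v (v , tt))) , λ v → ⊥-elim (¬v (v , tt))) p))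
  from : ∀ G → Outerplanar G → G ⊨ ex tt → G ⊨ φ
  from G outer (v , _) = preserved point G point-outerplanar outer ((λ _ → v) , λ _ _ ()) on-point
... | no ¬point with Sat? (Cyc 0) φ (emptyEnv (Cyc 0))
... | yes on-edge = ex (ex (E zero (suc zero))) , ex (ex (E zero (suc zero))) , λ G outer → to G outer , from G outer
  where
  to : ∀ G → Outerplanar G → G ⊨ φ → G ⊨ ex (ex (E zero (suc zero)))
  to G outer p with any? (λ u → any? λ v → edge? G v u)
  ... | yes e = e
  ... | no ¬e = ⊥-elim (¬point (preserved G point outer point-outerplanar
                  ((λ _ → zero) , λ u v e → ⊥-elim (¬e (v , u , e))) p))
  from : ∀ G → Outerplanar G → G ⊨ ex (ex (E zero (suc zero))) → G ⊨ φ
  from G outer (u , v , e) = preserved (Cyc 0) G (Cyc-outerplanar 0) outer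
    (circuit⇒hom {G = G} (walk⇒circuit (cons u e (cons v (edge-sym G e) nil)))) on-edge
... | no ¬edge with least-false {λ k → Cyc (suc (double k)) ⊨ φ} (λ k → Sat? (Cyc (suc (double k))) φ (emptyEnv (Cyc (suc (double k)))))
                      (threshold (rank φ)) long-odd
  where
  long-odd : ¬ (Cyc (suc (double (threshold (rank φ)))) ⊨ φ)
  long-odd p = ¬edge (preserved (Cyc (double K)) (Cyc 0) (Cyc-outerplanar _) (Cyc-outerplanar 0) (even-cycle⇒edge K)
    -- The odd cycle of length `2K + 3` is compared with the even one of length `2K + 2`; both are
    -- above the threshold.
    (long-cycles-agree φ (suc (double K)) (double K) (≤-trans (m≤double K) (n≤1+n _)) (m≤double K) p))
    where
    K : ℕ
    K = threshold (rank φ)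
... | k , ¬next , below = ex (walkFormula (suc (double k)) zero zero) , ex (walkFormula-ExPos (suc (double k)) zero zero) ,
                            λ G outer → to G outer , from G outer
  where
  to : ∀ G → Outerplanar G → G ⊨ φ → G ⊨ ex (walkFormula (suc (double k)) zero zero)
  to G outer p with any? (λ x → walk? G (suc (double k)) x x)
  ... | yes (x , w) = x , walk⇒walkFormula G (suc (double k)) zero zero (extend x (emptyEnv G)) refl refl w
  ... | no none = ⊥-elim (¬next (preserved G (Cyc (suc (double k))) outer (Cyc-outerplanar _) (outerplanar⇒hom outer k none) p))
  closed-walk⇒φ : ∀ i → i ≡ k → ∀ G → Outerplanar G → OddClosedWalk G i → G ⊨ φ
  -- If `k` is 0, then `φ` fails already in the triangle, the top of the chain, and the sentence
  -- asks for a loop, so it is false everywhere.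
  closed-walk⇒φ zero _ G outer (x , cons _ e nil) = ⊥-elim (no-loop G e)
  -- A closed walk of length `2k + 1 = 2i + 3` is an image of the cycle of that length, where `φ`
  -- holds because `k` is the least index of failure.
  closed-walk⇒φ (suc i) refl G outer (x , w) = preserved (Cyc (suc (double i))) G (Cyc-outerplanar _) outer
    (circuit⇒hom (walk⇒circuit w)) (below i ≤-refl)
  from : ∀ G → Outerplanar G → G ⊨ ex (walkFormula (suc (double k)) zero zero) → G ⊨ φ
  from G outer (x , p) = closed-walk⇒φ k refl G outer (x , walkFormula⇒walk G (suc (double k)) zero zero (extend x (emptyEnv G)) p)
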